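{- Let $0<\beta\le 1/2$ and $\delta:=18\beta$. Then $\mathbf{Bad}(\delta)$ is a $(1/2,\beta)$-ubiquitously losing set of $\mathbb{R}$.
   Context: For $\delta>0$, $\mathbf{Bad}(\delta)$ denotes the set of irrational real numbers $x$ for which there exists an integer $Q>0$ (depending on $x$) such that $|x-p/q|\ge \delta/q^2$ for all integers $q\ge Q$ and all integers $p$ coprime to $q$. Schmidt game: for a closed ball $B$ (positive radius, radius denoted $\rho(B)$) and $0<\gamma\le 1$, let $B^\gamma$ be the collection of closed balls $\widetilde B\subset B$ with $\rho(\widetilde B)=\gamma\rho(B)$. For $S\subset\mathbb{R}^d$ and $0<\alpha,\beta<1$, in the $(\alpha,\beta;S)$-game Bob chooses a closed ball $B_1$, and then, for $n\ge1$, Alice chooses $A_n\in B_n^\alpha$ and Bob chooses $B_{n+1}\in A_n^\beta$. The intersection $\bigcap_{n} B_n$ is a single point. $S$ is an $(\alpha,\beta)$-ubiquitously losing set of $\mathbb{R}^d$ if, for every choice of closed ball $B_1$, Bob has a strategy for the game with initial ball $B_1$ ensuring, whatever Alice plays, that this point lies in the complement $S^c$. Here $d=1$ and closed balls are closed bounded intervals of positive length. -}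

module Defs where

open import Data.Integer.Base as ℤ using (ℤ; +_)
open import Data.Integer.Coprimality using (Coprime)
open import Data.List.Base using (List; []; _∷_)
open import Data.Nat.Base as ℕ using (ℕ; zero; suc; _⊔_)
import Data.Nat.Properties as ℕ
open import Data.Product using (Σ; ∃; _×_; _,_)
open import Data.Rational.Base as ℚ using (ℚ; 0ℚ; 1ℚ; ½)
import Data.Rational.Properties as ℚ
open import Data.Rational.Solver using (module +-*-Solver)
open import Data.Sum.Base using (inj₁; inj₂)
open import Relation.Binary.PropositionalEquality
  using (_≡_; refl; sym; trans; cong; cong₂; subst; subst₂)
open import Relation.Nullary.Negation using (¬_)

infixl 6 _+_ _-_
infixl 7 _*_
infix  8 -_
infix  4 _≃_ _≤_ _<_ _∈_ _⊆_ _∈_^_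

-- The reals are Cauchy sequences of rationals, compared by the setoid
-- equality _≃_.  Operations act termwise.

IsCauchy : (ℕ → ℚ) → Set
IsCauchy s = ∀ ε → 0ℚ ℚ.< ε →
  ∃ λ N → ∀ m n → N ℕ.≤ m → N ℕ.≤ n → ℚ.∣ s m ℚ.- s n ∣ ℚ.< ε

record ℝ : Set where
  constructor mkℝ
  field
    seq    : ℕ → ℚ
    cauchy : IsCauchy seq

open ℝ public

record _≃_ (x y : ℝ) : Set where
  constructor *≃*
  field
    close : ∀ ε → 0ℚ ℚ.< ε →
      ∃ λ N → ∀ n → N ℕ.≤ n → ℚ.∣ seq x n ℚ.- seq y n ∣ ℚ.< ε

record _≤_ (x y : ℝ) : Set where
  constructor *≤*
  field
    below : ∀ ε → 0ℚ ℚ.< ε →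
      ∃ λ N → ∀ n → N ℕ.≤ n → seq x n ℚ.≤ seq y n ℚ.+ ε

record _<_ (x y : ℝ) : Set where
  constructor *<*
  field
    gap   : ℚ
    gap>0 : 0ℚ ℚ.< gap
    apart : ∃ λ N → ∀ n → N ℕ.≤ n → seq x n ℚ.+ gap ℚ.≤ seq y n

private
  abstract
    half+half : ∀ ε → ½ ℚ.* ε ℚ.+ ½ ℚ.* ε ≡ ε
    half+half ε = trans (sym (ℚ.*-distribʳ-+ ε ½ ½)) (ℚ.*-identityˡ ε)

    0<*0< : ∀ {p q} → 0ℚ ℚ.< p → 0ℚ ℚ.< q → 0ℚ ℚ.< p ℚ.* q
    0<*0< {p} {q} 0<p 0<q =
      subst (ℚ._< p ℚ.* q) (ℚ.*-zeroʳ p)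
        (ℚ.*-monoʳ-<-pos p {{ℚ.positive 0<p}} 0<q)

    half-pos : ∀ {ε} → 0ℚ ℚ.< ε → 0ℚ ℚ.< ½ ℚ.* ε
    half-pos = 0<*0< (ℚ.positive⁻¹ ½)

    neg-diff : ∀ p q → ℚ.- p ℚ.- (ℚ.- q) ≡ ℚ.- (p ℚ.- q)
    neg-diff = solve 2 (λ p q → :- p :- (:- q) := :- (p :- q)) refl
      where open +-*-Solver

    sum-diff : ∀ p q r s →
               (p ℚ.+ q) ℚ.- (r ℚ.+ s) ≡ (p ℚ.- r) ℚ.+ (q ℚ.- s)
    sum-diff = solve 4 (λ p q r s →
        (p :+ q) :- (r :+ s) := (p :- r) :+ (q :- s)) refl
      where open +-*-Solver

    product-diff : ∀ p q r s →
      (p ℚ.* q) ℚ.- (r ℚ.* s) ≡ p ℚ.* (q ℚ.- s) ℚ.+ s ℚ.* (p ℚ.- r)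
    product-diff = solve 4 (λ p q r s →
        (p :* q) :- (r :* s) := p :* (q :- s) :+ s :* (p :- r)) refl
      where open +-*-Solver

    q+[p-q]≡p : ∀ p q → q ℚ.+ (p ℚ.- q) ≡ p
    q+[p-q]≡p = solve 2 (λ p q → q :+ (p :- q) := p) refl
      where open +-*-Solver

    [p-q]+q≡p : ∀ p q → (p ℚ.- q) ℚ.+ q ≡ p
    [p-q]+q≡p = solve 2 (λ p q → (p :- q) :+ q := p) refl
      where open +-*-Solver

    neg-minus : ∀ p q → ℚ.- (p ℚ.- q) ≡ q ℚ.- p
    neg-minus = solve 2 (λ p q → :- (p :- q) := q :- p) refl
      where open +-*-Solver

    ∣p∣-∣q∣≤∣p-q∣ : ∀ p q → ℚ.∣ p ∣ ℚ.- ℚ.∣ q ∣ ℚ.≤ ℚ.∣ p ℚ.- q ∣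
    ∣p∣-∣q∣≤∣p-q∣ p q = begin
      ℚ.∣ p ∣ ℚ.- ℚ.∣ q ∣
        ≡⟨ cong (λ r → ℚ.∣ r ∣ ℚ.- ℚ.∣ q ∣) (sym ([p-q]+q≡p p q)) ⟩
      ℚ.∣ (p ℚ.- q) ℚ.+ q ∣ ℚ.- ℚ.∣ q ∣
        ≤⟨ ℚ.+-monoˡ-≤ (ℚ.- ℚ.∣ q ∣) (ℚ.∣p+q∣≤∣p∣+∣q∣ (p ℚ.- q) q) ⟩
      (ℚ.∣ p ℚ.- q ∣ ℚ.+ ℚ.∣ q ∣) ℚ.- ℚ.∣ q ∣
        ≡⟨ cancel ℚ.∣ p ℚ.- q ∣ ℚ.∣ q ∣ ⟩
      ℚ.∣ p ℚ.- q ∣ ∎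
      where
      open ℚ.≤-Reasoning
      open +-*-Solver
      cancel : ∀ a b → (a ℚ.+ b) ℚ.- b ≡ a
      cancel = solve 2 (λ a b → (a :+ b) :- b := a) refl

    ∣∣p∣-∣q∣∣≤∣p-q∣ : ∀ p q → ℚ.∣ ℚ.∣ p ∣ ℚ.- ℚ.∣ q ∣ ∣ ℚ.≤ ℚ.∣ p ℚ.- q ∣
    ∣∣p∣-∣q∣∣≤∣p-q∣ p q with ℚ.∣p∣≡p∨∣p∣≡-p (ℚ.∣ p ∣ ℚ.- ℚ.∣ q ∣)
    ... | inj₁ eq = subst (ℚ._≤ ℚ.∣ p ℚ.- q ∣) (sym eq) (∣p∣-∣q∣≤∣p-q∣ p q)
    ... | inj₂ eq = subst₂ ℚ._≤_
      (sym (trans eq (neg-minus ℚ.∣ p ∣ ℚ.∣ q ∣)))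
      (trans (cong ℚ.∣_∣ (sym (neg-minus p q))) (ℚ.∣-p∣≡∣p∣ (p ℚ.- q)))
      (∣p∣-∣q∣≤∣p-q∣ q p)

    bounded : ∀ {s} → IsCauchy s → ∃ λ K → 0ℚ ℚ.< K ×
              (∃ λ N → ∀ n → N ℕ.≤ n → ℚ.∣ s n ∣ ℚ.≤ K)
    bounded {s} c with c 1ℚ (ℚ.positive⁻¹ 1ℚ)
    ... | N , close = ℚ.∣ s N ∣ ℚ.+ 1ℚ
      , ℚ.+-mono-≤-< (ℚ.0≤∣p∣ (s N)) (ℚ.positive⁻¹ 1ℚ)
      , N , λ n N≤n → let open ℚ.≤-Reasoning in begin
          ℚ.∣ s n ∣
            ≡⟨ cong ℚ.∣_∣ (sym (q+[p-q]≡p (s n) (s N))) ⟩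
          ℚ.∣ s N ℚ.+ (s n ℚ.- s N) ∣
            ≤⟨ ℚ.∣p+q∣≤∣p∣+∣q∣ (s N) (s n ℚ.- s N) ⟩
          ℚ.∣ s N ∣ ℚ.+ ℚ.∣ s n ℚ.- s N ∣
            ≤⟨ ℚ.+-monoʳ-≤ ℚ.∣ s N ∣ (ℚ.<⇒≤ (close n N N≤n ℕ.≤-refl)) ⟩
          ℚ.∣ s N ∣ ℚ.+ 1ℚ ∎

    ∣*∣-mono : ∀ p {q K η} → ℚ.∣ p ∣ ℚ.≤ K → 0ℚ ℚ.< K → ℚ.∣ q ∣ ℚ.< η →
               ℚ.∣ p ℚ.* q ∣ ℚ.< K ℚ.* η
    ∣*∣-mono p {q} {K} {η} p≤K 0<K q<η = begin-strict
      ℚ.∣ p ℚ.* q ∣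
        ≡⟨ ℚ.∣p*q∣≡∣p∣*∣q∣ p q ⟩
      ℚ.∣ p ∣ ℚ.* ℚ.∣ q ∣
        ≤⟨ ℚ.*-monoʳ-≤-nonNeg ℚ.∣ q ∣ {{ℚ.∣-∣-nonNeg q}} p≤K ⟩
      K ℚ.* ℚ.∣ q ∣
        <⟨ ℚ.*-monoʳ-<-pos K {{ℚ.positive 0<K}} q<η ⟩
      K ℚ.* η ∎
      where open ℚ.≤-Reasoning

    +-cauchy : ∀ {s t} → IsCauchy s → IsCauchy t →
               IsCauchy (λ n → s n ℚ.+ t n)
    +-cauchy {s} {t} cs ct ε 0<ε
      with cs (½ ℚ.* ε) (half-pos 0<ε) | ct (½ ℚ.* ε) (half-pos 0<ε)
    ... | M , closeS | N , closeT = M ⊔ N , λ m n m≥ n≥ →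
      let open ℚ.≤-Reasoning in begin-strict
        ℚ.∣ (s m ℚ.+ t m) ℚ.- (s n ℚ.+ t n) ∣
          ≡⟨ cong ℚ.∣_∣ (sum-diff (s m) (t m) (s n) (t n)) ⟩
        ℚ.∣ (s m ℚ.- s n) ℚ.+ (t m ℚ.- t n) ∣
          ≤⟨ ℚ.∣p+q∣≤∣p∣+∣q∣ (s m ℚ.- s n) (t m ℚ.- t n) ⟩
        ℚ.∣ s m ℚ.- s n ∣ ℚ.+ ℚ.∣ t m ℚ.- t n ∣
          <⟨ ℚ.+-mono-<
               (closeS m n (ℕ.m⊔n≤o⇒m≤o M N m≥) (ℕ.m⊔n≤o⇒m≤o M N n≥))
               (closeT m n (ℕ.m⊔n≤o⇒n≤o M N m≥) (ℕ.m⊔n≤o⇒n≤o M N n≥)) ⟩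
        ½ ℚ.* ε ℚ.+ ½ ℚ.* ε
          ≡⟨ half+half ε ⟩
        ε ∎

    neg-cauchy : ∀ {s} → IsCauchy s → IsCauchy (λ n → ℚ.- s n)
    neg-cauchy {s} cs ε 0<ε with cs ε 0<ε
    ... | N , close = N , λ m n m≥ n≥ → subst (ℚ._< ε)
      (sym (trans (cong ℚ.∣_∣ (neg-diff (s m) (s n))) (ℚ.∣-p∣≡∣p∣ (s m ℚ.- s n))))
      (close m n m≥ n≥)

    abs-cauchy : ∀ {s} → IsCauchy s → IsCauchy (λ n → ℚ.∣ s n ∣)
    abs-cauchy {s} cs ε 0<ε with cs ε 0<ε
    ... | N , close = N , λ m n m≥ n≥ →
      ℚ.≤-<-trans (∣∣p∣-∣q∣∣≤∣p-q∣ (s m) (s n)) (close m n m≥ n≥)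

    product-close : ∀ a b c d {K L η} →
      ℚ.∣ a ∣ ℚ.≤ K → 0ℚ ℚ.< K → ℚ.∣ d ∣ ℚ.≤ L → 0ℚ ℚ.< L →
      ℚ.∣ a ℚ.- c ∣ ℚ.< η → ℚ.∣ b ℚ.- d ∣ ℚ.< η →
      ℚ.∣ a ℚ.* b ℚ.- c ℚ.* d ∣ ℚ.< (K ℚ.+ L) ℚ.* η
    product-close a b c d {K} {L} {η} a≤K 0<K d≤L 0<L a~c b~d = begin-strict
      ℚ.∣ a ℚ.* b ℚ.- c ℚ.* d ∣
        ≡⟨ cong ℚ.∣_∣ (product-diff a b c d) ⟩
      ℚ.∣ a ℚ.* (b ℚ.- d) ℚ.+ d ℚ.* (a ℚ.- c) ∣
        ≤⟨ ℚ.∣p+q∣≤∣p∣+∣q∣ (a ℚ.* (b ℚ.- d)) (d ℚ.* (a ℚ.- c)) ⟩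
      ℚ.∣ a ℚ.* (b ℚ.- d) ∣ ℚ.+ ℚ.∣ d ℚ.* (a ℚ.- c) ∣
        <⟨ ℚ.+-mono-< (∣*∣-mono a a≤K 0<K b~d) (∣*∣-mono d d≤L 0<L a~c) ⟩
      K ℚ.* η ℚ.+ L ℚ.* η
        ≡⟨ sym (ℚ.*-distribʳ-+ η K L) ⟩
      (K ℚ.+ L) ℚ.* η ∎
      where open ℚ.≤-Reasoning

    divide : ∀ S ε → 0ℚ ℚ.< S → 0ℚ ℚ.< ε → ∃ λ η → 0ℚ ℚ.< η × S ℚ.* η ≡ ε
    divide S ε 0<S 0<ε = (ℚ.1/ S) ℚ.* ε
      , 0<*0< (ℚ.positive⁻¹ (ℚ.1/ S) {{ℚ.1/pos⇒pos S}}) 0<ε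
      , trans (sym (ℚ.*-assoc S (ℚ.1/ S) ε))
          (trans (cong (ℚ._* ε) (ℚ.*-inverseʳ S)) (ℚ.*-identityˡ ε))
      where
      instance
        pos : ℚ.Positive S
        pos = ℚ.positive 0<S
        nz : ℚ.NonZero S
        nz = ℚ.pos⇒nonZero S

    *-cauchy : ∀ {s t} → IsCauchy s → IsCauchy t →
               IsCauchy (λ n → s n ℚ.* t n)
    *-cauchy {s} {t} cs ct ε 0<ε =
      let K , 0<K , M₁ , s≤K = bounded cs
          L , 0<L , N₁ , t≤L = bounded ct
          η , 0<η , [K+L]η≡ε = divide (K ℚ.+ L) ε (ℚ.+-mono-< 0<K 0<L) 0<ε
          M₂ , closeS = cs η 0<η
          N₂ , closeT = ct η 0<η
      in (M₁ ⊔ N₁) ⊔ (M₂ ⊔ N₂) , λ m n m≥ n≥ →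
        let m≥₁ = ℕ.m⊔n≤o⇒m≤o (M₁ ⊔ N₁) (M₂ ⊔ N₂) m≥
            m≥₂ = ℕ.m⊔n≤o⇒n≤o (M₁ ⊔ N₁) (M₂ ⊔ N₂) m≥
            n≥₁ = ℕ.m⊔n≤o⇒m≤o (M₁ ⊔ N₁) (M₂ ⊔ N₂) n≥
            n≥₂ = ℕ.m⊔n≤o⇒n≤o (M₁ ⊔ N₁) (M₂ ⊔ N₂) n≥
        in subst (ℚ.∣ s m ℚ.* t m ℚ.- s n ℚ.* t n ∣ ℚ.<_) [K+L]η≡ε
          (product-close (s m) (t m) (s n) (t n)
            (s≤K m (ℕ.m⊔n≤o⇒m≤o M₁ N₁ m≥₁)) 0<K
            (t≤L n (ℕ.m⊔n≤o⇒n≤o M₁ N₁ n≥₁)) 0<L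
            (closeS m n (ℕ.m⊔n≤o⇒m≤o M₂ N₂ m≥₂) (ℕ.m⊔n≤o⇒m≤o M₂ N₂ n≥₂))
            (closeT m n (ℕ.m⊔n≤o⇒n≤o M₂ N₂ m≥₂) (ℕ.m⊔n≤o⇒n≤o M₂ N₂ n≥₂)))

fromℚ : ℚ → ℝ
fromℚ p = mkℝ (λ _ → p) λ ε 0<ε →
  0 , λ _ _ _ _ → subst (ℚ._< ε) (cong ℚ.∣_∣ (sym (ℚ.+-inverseʳ p))) 0<ε

fromℕ : ℕ → ℝ
fromℕ n = fromℚ (+ n ℚ./ 1)

0ℝ ½ℝ : ℝ
0ℝ = fromℚ 0ℚ
½ℝ = fromℚ ½

_+_ _*_ : ℝ → ℝ → ℝ
x + y = mkℝ (λ n → seq x n ℚ.+ seq y n)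
            (+-cauchy {seq x} {seq y} (cauchy x) (cauchy y))
x * y = mkℝ (λ n → seq x n ℚ.* seq y n)
            (*-cauchy {seq x} {seq y} (cauchy x) (cauchy y))

-_ ∣_∣ : ℝ → ℝ
- x = mkℝ (λ n → ℚ.- seq x n) (neg-cauchy {seq x} (cauchy x))
∣ x ∣ = mkℝ (λ n → ℚ.∣ seq x n ∣) (abs-cauchy {seq x} (cauchy x))

_-_ : ℝ → ℝ → ℝ
x - y = x + (- y)

Irrational : ℝ → Set
Irrational x = ∀ (r : ℚ) → ¬ (x ≃ fromℚ r)

-- The bound δ/q² is written as δ * fromℚ (1/(q·q)).
Bad : ℝ → ℝ → Set
Bad δ x = Irrational x ×
  (∃ λ (Q : ℕ) → 0 ℕ.< Q ×
    (∀ (q : ℕ) .{{_ : ℕ.NonZero q}} → Q ℕ.≤ q →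
     ∀ (p : ℤ) → Coprime p (+ q) →
     δ * fromℚ (ℚ._/_ (+ 1) (q ℕ.* q) {{ℕ.m*n≢0 q q}}) ≤ ∣ x - fromℚ (p ℚ./ q) ∣))

record Ball : Set where
  field
    centre   : ℝ
    radius   : ℝ
    radius>0 : 0ℝ < radius

open Ball public

_∈_ : ℝ → Ball → Set
x ∈ B = ∣ x - centre B ∣ ≤ radius B

_⊆_ : Ball → Ball → Set
B ⊆ C = ∀ x → x ∈ B → x ∈ C

-- C ∈ B ^ γ : C is one of the balls in the collection B^γ.
_∈_^_ : Ball → Ball → ℝ → Set
C ∈ B ^ γ = C ⊆ B × radius C ≃ γ * radius B

-- A strategy for Bob answers Alice's current ball A, given her earlier balls
-- (latest first), with a legal ball in A^β.  Bob's own earlier balls are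
-- determined by B₁ and Alice's moves, so they are not part of the input.
record Strategy (β : ℝ) : Set where
  field
    reply : List Ball → Ball → Ball
    legal : ∀ As A → reply As A ∈ A ^ β

open Strategy public

-- Indices are shifted: A n and bob B₁ σ A n are the balls A_{n+1}, B_{n+1}.
earlier : (ℕ → Ball) → ℕ → List Ball
earlier A zero    = []
earlier A (suc n) = A n ∷ earlier A n

bob : ∀ {β} → Ball → Strategy β → (ℕ → Ball) → ℕ → Ball
bob B₁ σ A zero    = B₁
bob B₁ σ A (suc n) = reply σ (earlier A n) (A n)

-- The balls of a play meet in exactly one point; x is that point.
UbiquitouslyLosing : (α β : ℝ) → (ℝ → Set) → Set
UbiquitouslyLosing α β S =
  ∀ (B₁ : Ball) → Σ (Strategy β) λ σ →
  ∀ (A : ℕ → Ball) → (∀ n → A n ∈ bob B₁ σ A n ^ α) →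
  ∀ x → (∀ n → x ∈ bob B₁ σ A n) → ¬ S x

module Submission where

-- Bob wants the point x of the play to lie within 18β/q² of p/q for infinitely many
-- fractions p/q.  Let r be the radius of Alice's current ball.  If p/q lies well inside
-- it and q² r < 18, a ball of Bob of radius β r around p/q is such a success.  Otherwise
-- suppose p/q was just made the centre of a ball.  As α = 1/2, Alice's answer still
-- contains p/q, and Bob moves away from it to a distance 1/(q m), where the fractions
-- adjacent to p/q have denominators q′ ≈ m and are spaced like the radius of the ball
-- Alice plays next.  She cannot avoid having one of them well inside, and m is tuned so
-- that q′² times her radius is of order one.  The same detour works for every p/q with
-- 1 ≲ q² r ≲ 1/β², a range longer than the factor β/2 by which r shrinks in a round;
-- hence if Bob keeps looking out for such p/q and otherwise waits, then any convergent
-- p/q of an irrational x gives him the opportunity to start.  Once the radius is small,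
-- all these q are large.  If β is not small, no irrational x is in Bad(18β), because
-- |x − p/q| ≤ 1/(2q²) has infinitely many solutions.

open import Data.Bool.Base using (Bool; true; false; not)
open import Data.Bool.Properties using (not-involutive)
open import Data.Empty using (⊥)
open import Data.Integer.Base as ℤ using (ℤ; +_; -[1+_])
open import Data.Integer.DivMod using (_/ℕ_; _%ℕ_; n%ℕd<d; a≡a%ℕn+[a/ℕn]*n)
import Data.Integer.Divisibility.Signed as Signed
import Data.Integer.Properties as ℤ
open import Data.Integer.Tactic.RingSolver using (solve-∀)
open import Data.Nat.Base as ℕ using (ℕ; zero; suc)
open import Data.Nat.Coprimality as Coprime using (Coprime; coprime-Bézout)
import Data.Nat.Divisibility as ℕ
open import Data.Nat.GCD using (module Bézout)
import Data.Nat.Properties as ℕ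
open import Data.Product using (Σ; ∃; ∃₂; _×_; _,_; proj₁; proj₂)
open import Data.Rational.Base as ℚ using (ℚ; mkℚ; 0ℚ; 1ℚ; ↥_; ↧ₙ_)
import Data.Rational.Properties as ℚ
open import Data.Rational.Solver using (module +-*-Solver)
open import Data.Rational.Unnormalised.Base using (mkℚᵘ; *≡*)
import Data.Rational.Unnormalised.Properties as ℚᵘ
open import Data.Sum.Base using (_⊎_; inj₁; inj₂; [_,_]′)
open import Relation.Binary.PropositionalEquality
  using (_≡_; refl; sym; trans; cong; cong₂; subst; subst₂; module ≡-Reasoning)
open import Relation.Nullary.Decidable using (Dec; yes; no; map′; _×-dec_; _⊎-dec_)
open import Relation.Nullary.Negation using (¬_; contradiction)
open +-*-Solver using (Polynomial; solve; con; _:=_; _:+_; _:*_; _:-_; :-_)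

-- The constructive setting shapes the proof in two ways. Bob's reply has to be a function, but
-- inequalities between reals cannot be decided. So each ball is represented by rationals for its
-- centre and radius, and β by a rational `b`. The conditions for his moves are rational
-- inequalities that bound the fractions in question; a finite search decides them, and their
-- constants leave room for the errors. Good approximations of x, by contrast, exist only up to
-- double negation, because irrationality is a negative statement. This suffices, since the goal is
-- a negation and the strategy does not see x.
--
-- The strategy has no memory: a reply depends on Alice's current ball alone. A preparation does not
-- bind Bob to a detour around the same fraction; it ensures that some detour exists, and a detour
-- that some hit exists. Bob prefers hits to detours and detours to preparations.
--
-- The factor 18 has two sources. A detour yields a fraction with u q² at most 17, and the remaining
-- 1 absorbs errors; and 18/32 exceeds 1/2, which settles every β with b at least 1/32.

module Integers where
  open import Data.Integer.Base using (_+_; _*_; _-_; -_; ∣_∣)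

  -- Fractions p′/q′ with p′q - pq′ = ±1

  ℤ-bézout : ∀ p q → Coprime ∣ p ∣ q → ∃₂ λ x y → x * p + y * + q ≡ + 1
  ℤ-bézout (+ m) q c with coprime-Bézout c
  ... | Bézout.+- x y eq = + x , - (+ y) , lemma
    where
    open ≡-Reasoning
    lemma : + x * + m + - + y * + q ≡ + 1
    lemma = begin
      + x * + m + - + y * + q              ≡⟨ cong (λ t → t + - + y * + q) (ℤ.pos-* x m) ⟨
      + (x ℕ.* m) + - + y * + q            ≡⟨ cong (λ t → + t + - + y * + q) eq ⟨
      + 1 + + (y ℕ.* q) + - + y * + q      ≡⟨ cong (λ t → + 1 + t + - + y * + q) (ℤ.pos-* y q) ⟩
      + 1 + + y * + q + - + y * + q        ≡⟨ cancel (+ 1) (+ y) (+ q) ⟩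
      + 1                                  ∎
      where
      cancel : ∀ a b c → a + b * c + - b * c ≡ a
      cancel = solve-∀
  ... | Bézout.-+ x y eq = - (+ x) , + y , lemma
    where
    open ≡-Reasoning
    lemma : - + x * + m + + y * + q ≡ + 1
    lemma = begin
      - + x * + m + + y * + q              ≡⟨ cong (λ t → - + x * + m + t) (ℤ.pos-* y q) ⟨
      - + x * + m + + (y ℕ.* q)            ≡⟨ cong (λ t → - + x * + m + + t) eq ⟨
      - + x * + m + (+ 1 + + (x ℕ.* m))    ≡⟨ cong (λ t → - + x * + m + (+ 1 + t)) (ℤ.pos-* x m) ⟩
      - + x * + m + (+ 1 + + x * + m)      ≡⟨ cancel (+ 1) (+ x) (+ m) ⟩
      + 1                                  ∎
      where
      cancel : ∀ a b c → - b * c + (a + b * c) ≡ a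
      cancel = solve-∀
  ℤ-bézout -[1+ m ] q c with ℤ-bézout (+ suc m) q c
  ... | x , y , eq = - x , y , trans (cong (λ t → t + y * + q) (negs x (+ suc m))) eq
    where
    negs : ∀ x a → - x * - a ≡ x * a
    negs = solve-∀

  -- With x p + y q = 1, the congruence to solve is r + 1 ≡ -σx modulo q. Reducing -σx - 1 instead
  -- of -σx puts the denominator `suc r` between 1 and q, so that it is never 0.
  cross-difference : ∀ p q .{{_ : ℕ.NonZero q}} → Coprime ∣ p ∣ q → ∀ σ →
    ∃₂ λ p₀ r → r ℕ.< q × p₀ * + q - p * + suc r ≡ σ
  cross-difference p q c σ with ℤ-bézout p q c
  ... | x , y , eq = σ * y - t * p , r , n%ℕd<d s q , (begin
    (σ * y - t * p) * + q - p * + suc r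
      ≡⟨ rearrange₁ σ y t p (+ q) (+ r) ⟩
    σ * (y * + q) - p * (+ 1 + (+ r + t * + q))
      ≡⟨ cong (λ k → σ * (y * + q) - p * (+ 1 + k)) (a≡a%ℕn+[a/ℕn]*n s q) ⟨
    σ * (y * + q) - p * (+ 1 + s)
      ≡⟨ rearrange₂ σ (y * + q) p x ⟩
    σ * (x * p + y * + q)
      ≡⟨ cong (σ *_) eq ⟩
    σ * + 1
      ≡⟨ ℤ.*-identityʳ σ ⟩
    σ ∎)
    where
    open ≡-Reasoning
    s = - (σ * x) - + 1
    r = s %ℕ q
    t = s /ℕ q
    rearrange₁ : ∀ σ y t p q r →
        (σ * y - t * p) * q - p * (+ 1 + r) ≡ σ * (y * q) - p * (+ 1 + (r + t * q))
    rearrange₁ = solve-∀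
    rearrange₂ : ∀ σ a p x → σ * a - p * (+ 1 + (- (σ * x) - + 1)) ≡ σ * (x * p + a)
    rearrange₂ = solve-∀

  cross-difference-shift : ∀ p q p₀ r k {σ} → p₀ * + q - p * + suc r ≡ σ →
    (+ k * p + p₀) * + q - p * + suc (k ℕ.* q ℕ.+ r) ≡ σ
  cross-difference-shift p q p₀ r k eq = trans (begin
    (+ k * p + p₀) * + q - p * (+ 1 + (+ (k ℕ.* q) + + r))
      ≡⟨ cong (λ t → (+ k * p + p₀) * + q - p * (+ 1 + (t + + r))) (ℤ.pos-* k q) ⟩
    (+ k * p + p₀) * + q - p * (+ 1 + (+ k * + q + + r))
      ≡⟨ rearrange (+ k) p p₀ (+ q) (+ r) ⟩
    p₀ * + q - p * (+ 1 + + r) ∎) eq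
    where
    open ≡-Reasoning
    rearrange : ∀ k p p₀ q r →
      (k * p + p₀) * q - p * (+ 1 + (k * q + r)) ≡ p₀ * q - p * (+ 1 + r)
    rearrange = solve-∀

  -- A common divisor of p′ and q′ divides σ. Hence these fractions are already in lowest terms, and
  -- their denominators are known exactly.
  cross-difference⇒coprime : ∀ p q p′ q′ {σ} → ∣ σ ∣ ≡ 1 → p′ * + q - p * + q′ ≡ σ →
      Coprime ∣ p′ ∣ q′
  cross-difference⇒coprime p q p′ q′ {σ} ∣σ∣≡1 eq {d} (d∣p′ , d∣q′)
    with Signed.∣ᵤ⇒∣ {+ d} {p′} d∣p′ | Signed.∣ᵤ⇒∣ {+ d} {+ q′} d∣q′
  ... | Signed.divides a refl | Signed.divides b eqq =
    ℕ.∣1⇒≡1 (subst (d ℕ.∣_) ∣σ∣≡1 (Signed.∣⇒∣ᵤ (Signed.divides (a * + q - p * b) σ≡)))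
    where
    rearrange : ∀ a b d q p → a * d * q - p * (b * d) ≡ (a * q - p * b) * d
    rearrange = solve-∀
    σ≡ : σ ≡ (a * + q - p * b) * + d
    σ≡ = trans (sym eq) (trans (cong (λ t → a * + d * + q - p * t) eqq)
        (rearrange a b (+ d) (+ q) p))

open Integers

module Rationals where
  open import Data.Rational.Base using (_+_; _-_; _*_; -_; _≤_; _<_; _/_; ∣_∣)
  open import Defs using (ℝ; seq; cauchy; Irrational; IsCauchy; *≃*)

  -- Ordered field arithmetic

  infixr 5 _⊕_ _<⊕_
  infixl 8 _÷_
  infixr 6 _⊛_ _⊛<_
  infixr 7 _⊗_

  fromℤ : ℤ → ℚ
  fromℤ i = mkℚ i 0 (Coprime.sym (Coprime.1-coprimeTo ℤ.∣ i ∣))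

  ι : ℕ → ℚ
  ι n = fromℤ (+ n)

  # : ∀ {n} → ℕ → Polynomial n
  # k = con (ι k)

  _÷_ : ∀ (n d : ℕ) .{{_ : ℕ.NonZero d}} → ℚ
  n ÷ d = + n / d

  fromℤ-* : ∀ i j → fromℤ (i ℤ.* j) ≡ fromℤ i * fromℤ j
  fromℤ-* i j = ℚ.toℚᵘ-injective (ℚᵘ.≃-sym (ℚ.toℚᵘ-homo-* (fromℤ i) (fromℤ j)))

  fromℤ-+ : ∀ i j → fromℤ (i ℤ.+ j) ≡ fromℤ i + fromℤ j
  fromℤ-+ i j = ℚ.toℚᵘ-injective (ℚᵘ.≃-trans
    (*≡* (cong (ℤ._* + 1) (sym (cong₂ ℤ._+_ (ℤ.*-identityʳ i) (ℤ.*-identityʳ j)))))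
    (ℚᵘ.≃-sym (ℚ.toℚᵘ-homo-+ (fromℤ i) (fromℤ j))))

  fromℤ-neg : ∀ i → fromℤ (ℤ.- i) ≡ - fromℤ i
  fromℤ-neg (+ zero)   = refl
  fromℤ-neg (+ suc n)  = refl
  fromℤ-neg (-[1+ n ]) = (solve 1 (λ x → x := :- (:- x)) refl x)
    where x = ι (suc n)

  fromℤ-- : ∀ i j → fromℤ (i ℤ.- j) ≡ fromℤ i - fromℤ j
  fromℤ-- i j = trans (fromℤ-+ i (ℤ.- j)) (cong (λ k → fromℤ i + k) (fromℤ-neg j))

  fromℤ-mono-≤ : ∀ {i j} → i ℤ.≤ j → fromℤ i ≤ fromℤ j
  fromℤ-mono-≤ i≤j = ℚ.*≤* (ℤ.*-monoʳ-≤-nonNeg (+ 1) i≤j)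

  fromℤ-cancel-≤ : ∀ {i j} → fromℤ i ≤ fromℤ j → i ℤ.≤ j
  fromℤ-cancel-≤ {i} {j} p = ℤ.*-cancelʳ-≤-pos i j (+ 1) (ℚ.drop-*≤* p)

  <⇒≱ : ∀ {a b} → a < b → ¬ (b ≤ a)
  <⇒≱ a<b b≤a = ℚ.<-irrefl refl (ℚ.<-≤-trans a<b b≤a)

  ι-mono-≤ : ∀ {m n} → m ℕ.≤ n → ι m ≤ ι n
  ι-mono-≤ m≤n = fromℤ-mono-≤ (ℤ.+≤+ m≤n)

  ι-cancel-≤ : ∀ {m n} → ι m ≤ ι n → m ℕ.≤ n
  ι-cancel-≤ p = ℤ.drop‿+≤+ (fromℤ-cancel-≤ p)

  ι-+ : ∀ m n → ι (m ℕ.+ n) ≡ ι m + ι n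
  ι-+ m n = fromℤ-+ (+ m) (+ n)

  ι-* : ∀ m n → ι (m ℕ.* n) ≡ ι m * ι n
  ι-* m n = trans (cong fromℤ (ℤ.pos-* m n)) (fromℤ-* (+ m) (+ n))

  0≤ι : ∀ n → 0ℚ ≤ ι n
  0≤ι n = ι-mono-≤ ℕ.z≤n

  0≤÷ : ∀ n d .{{_ : ℕ.NonZero d}} → 0ℚ ≤ n ÷ d
  0≤÷ n d = ℚ.nonNegative⁻¹ (n ÷ d) {{ℚ.normalize-nonNeg n d}}

  1≤ι : ∀ n .{{_ : ℕ.NonZero n}} → 1ℚ ≤ ι n
  1≤ι n = ι-mono-≤ (ℕ.>-nonZero⁻¹ n)

  -- An inequality follows from any other one with the same difference of sides;
  -- the identity between the differences is left to the ring solver.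
  lin : ∀ {a b l r} → l ≤ r → b - a ≡ r - l → a ≤ b
  lin {a} {b} {l} {r} l≤r eq = subst₂ _≤_ (solve 2 (λ l a → l :+ (a :- l) := a) refl l a)
    (trans (sym (solve 3 (λ r l a → r :- l :+ a := r :+ (a :- l)) refl r l a))
      (trans (cong (_+ a) (sym eq)) (solve 2 (λ b a → b :- a :+ a := b) refl b a)))
    (ℚ.+-monoˡ-≤ (a - l) l≤r)

  lin< : ∀ {a b l r} → l < r → b - a ≡ r - l → a < b
  lin< {a} {b} {l} {r} l<r eq = subst₂ _<_ (solve 2 (λ l a → l :+ (a :- l) := a) refl l a)
    (trans (sym (solve 3 (λ r l a → r :- l :+ a := r :+ (a :- l)) refl r l a))
      (trans (cong (_+ a) (sym eq)) (solve 2 (λ b a → b :- a :+ a := b) refl b a)))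
    (ℚ.+-monoˡ-< (a - l) l<r)

  _⊕_ : ∀ {a b c d} → a ≤ b → c ≤ d → a + c ≤ b + d
  _⊕_ = ℚ.+-mono-≤

  _<⊕_ : ∀ {a b c d} → a < b → c ≤ d → a + c < b + d
  _<⊕_ = ℚ.+-mono-<-≤

  _⊛_ : ∀ {k a b} → 0ℚ ≤ k → a ≤ b → k * a ≤ k * b
  _⊛_ {k} 0≤k = ℚ.*-monoˡ-≤-nonNeg k {{ℚ.nonNegative 0≤k}}

  _⊛<_ : ∀ {k a b} → 0ℚ < k → a < b → k * a < k * b
  _⊛<_ {k} 0<k = ℚ.*-monoʳ-<-pos k {{ℚ.positive 0<k}}

  _⊗_ : ∀ {a b} → 0ℚ ≤ a → 0ℚ ≤ b → 0ℚ ≤ a * b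
  _⊗_ {a} {b} 0≤a 0≤b = subst (_≤ a * b) (ℚ.*-zeroʳ a) (0≤a ⊛ 0≤b)

  0<⊗ : ∀ {a b} → 0ℚ < a → 0ℚ < b → 0ℚ < a * b
  0<⊗ {a} {b} 0<a 0<b = subst (_< a * b) (ℚ.*-zeroʳ a) (0<a ⊛< 0<b)

  0<ι : ∀ n .{{_ : ℕ.NonZero n}} → 0ℚ < ι n
  0<ι n = ℚ.<-≤-trans (ℚ.positive⁻¹ 1ℚ) (1≤ι n)

  0≤square : ∀ a → 0ℚ ≤ a * a
  0≤square a with ℚ.≤-total 0ℚ a
  ... | inj₁ 0≤a = 0≤a ⊗ 0≤a
  ... | inj₂ a≤0 = subst (0ℚ ≤_) (solve 1 (λ a → :- a :* (:- a) := a :* a) refl a) (0≤-a ⊗ 0≤-a)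
    where
    0≤-a : 0ℚ ≤ - a
    0≤-a = lin a≤0 (solve 1 (λ a → :- a :- # 0 := # 0 :- a) refl a)

  square-cancel-≤ : ∀ {a b} → 0ℚ ≤ b → a * a ≤ b * b → a ≤ b
  square-cancel-≤ {a} {b} 0≤b a²≤b² = ℚ.≮⇒≥ λ b<a →
    <⇒≱ (ℚ.≤-<-trans (0≤b ⊛ ℚ.<⇒≤ b<a)
      (subst (_< a * a) (ℚ.*-comm a b) (ℚ.≤-<-trans 0≤b b<a ⊛< b<a))) a²≤b²

  *-cancel-≤ : ∀ {k a b} → 0ℚ < k → k * a ≤ k * b → a ≤ b
  *-cancel-≤ {k} 0<k = ℚ.*-cancelˡ-≤-pos k {{ℚ.positive 0<k}}

  ∣∣≤⇒≤ : ∀ {a c} → ∣ a ∣ ≤ c → a ≤ c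
  ∣∣≤⇒≤ {a} p with ℚ.≤-total 0ℚ a
  ... | inj₁ 0≤a = subst (_≤ _) (ℚ.0≤p⇒∣p∣≡p 0≤a) p
  ... | inj₂ a≤0 = ℚ.≤-trans a≤0 (ℚ.≤-trans (ℚ.0≤∣p∣ a) p)

  ∣∣≤⇒-≤ : ∀ {a c} → ∣ a ∣ ≤ c → - a ≤ c
  ∣∣≤⇒-≤ {a} p = ∣∣≤⇒≤ (subst (_≤ _) (sym (ℚ.∣-p∣≡∣p∣ a)) p)

  ≤⇒∣∣≤ : ∀ {a c} → a ≤ c → - a ≤ c → ∣ a ∣ ≤ c
  ≤⇒∣∣≤ {a} p n with ℚ.∣p∣≡p∨∣p∣≡-p a
  ... | inj₁ eq = subst (_≤ _) (sym eq) p
  ... | inj₂ eq = subst (_≤ _) (sym eq) n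

  ∣a-b∣≡∣b-a∣ : ∀ a b → ∣ a - b ∣ ≡ ∣ b - a ∣
  ∣a-b∣≡∣b-a∣ a b = trans (sym (ℚ.∣-p∣≡∣p∣ (a - b))) (cong ∣_∣ (solve 2 (λ a b → :- (a :- b)
        := b :- a) refl a b))

  triangle : ∀ a c r → ∣ a - r ∣ ≤ ∣ a - c ∣ + ∣ c - r ∣
  triangle a c r = subst (λ t → ∣ t ∣ ≤ ∣ a - c ∣ + ∣ c - r ∣)
    (solve 3 (λ a c r → a :- c :+ (c :- r) := a :- r) refl a c r)
        (ℚ.∣p+q∣≤∣p∣+∣q∣ (a - c) (c - r))

  abstract
    reciprocal : ∀ a → 0ℚ < a → ∃ λ r → 0ℚ < r × r * a ≡ 1ℚ
    reciprocal a 0<a = (ℚ.1/ a) , ℚ.positive⁻¹ (ℚ.1/ a) {{ℚ.1/pos⇒pos a}} , ℚ.*-inverseˡ a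
      where instance
        pos : ℚ.Positive a
        pos = ℚ.positive 0<a
        nz : ℚ.NonZero a
        nz = ℚ.pos⇒nonZero a

  *-↧ : ∀ a → a * ι (↧ₙ a) ≡ fromℤ (↥ a)
  *-↧ a@record{} = ℚ.toℚᵘ-injective (ℚᵘ.≃-trans (ℚ.toℚᵘ-homo-* a (ι (↧ₙ a)))
    (*≡* (trans (ℤ.*-identityʳ _)
      (cong (λ k → ↥ a ℤ.* + k) (sym (ℕ.*-identityʳ (↧ₙ a)))))))

  0<ι↧ : ∀ a → 0ℚ < ι (↧ₙ a)
  0<ι↧ a@record{} = 0<ι (↧ₙ a)

  1≤ι↧ : ∀ a → 1ℚ ≤ ι (↧ₙ a)
  1≤ι↧ a@record{} = 1≤ι (↧ₙ a)

  ≤∣fromℤ∣ : ∀ i → fromℤ i ≤ ι ℤ.∣ i ∣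
  ≤∣fromℤ∣ (+ n)      = ℚ.≤-refl
  ≤∣fromℤ∣ -[1+ n ]   = fromℤ-mono-≤ ℤ.-≤+

  abstract
    ceiling : ∀ a → ∃ λ n → a ≤ ι n
    ceiling a with ℚ.≤-total 0ℚ a
    ... | inj₂ a≤0 = 0 , a≤0
    ... | inj₁ 0≤a = ℤ.∣ ↥ a ∣ , (begin
      a                ≤⟨ (lin ((0≤a ⊛ 1≤ι↧ a))
          (solve 2 (λ a k → a :* k :- a := a :* k :- a :* # 1) refl a k)) ⟩
      a * k            ≡⟨ *-↧ a ⟩
      fromℤ (↥ a)      ≤⟨ ≤∣fromℤ∣ (↥ a) ⟩
      ι ℤ.∣ ↥ a ∣      ∎)
      where
      open ℚ.≤-Reasoning
      k : ℚ
      k = ι (↧ₙ a)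

  1÷-* : ∀ n .{{_ : ℕ.NonZero n}} → (1 ÷ n) * ι n ≡ 1ℚ
  1÷-* (suc n) = ℚ.toℚᵘ-injective (ℚᵘ.≃-trans (ℚ.toℚᵘ-homo-* (1 ÷ suc n) (ι (suc n)))
    (ℚᵘ.≃-trans (ℚᵘ.*-congʳ (ℚ.toℚᵘ-fromℚᵘ (mkℚᵘ (+ 1) n)))
      (*≡* (trans (ℤ.*-identityʳ _)
          (trans (ℤ.*-identityˡ _) (sym
              (trans (ℤ.*-identityˡ _) (cong +_ (ℕ.*-identityʳ (suc n))))))))))

  -- The search descends from K only as long as P holds, so the result need not be the least
  -- solution; what is used is that its predecessor fails.
  least : ∀ {ℓ} {P : ℕ → Set ℓ} → (∀ n → Dec (P n)) → ∀ K → P K →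
    ∃ λ n → P n × (∀ k → n ≡ suc k → ¬ P k)
  least P? zero    PK = 0 , PK , λ _ ()
  least P? (suc K) PK with P? K
  ... | yes PK′ = least P? K PK′
  ... | no ¬PK′ = suc K , PK , λ { _ refl → ¬PK′ }

  archimedean : ∀ a b → 0ℚ < b → ∃ λ n → a ≤ ι n * b
  archimedean a b 0<b with reciprocal b 0<b
  ... | r , 0<r , rb≡1 with ceiling (a * r)
  ... | n , ar≤n = n , (begin
    a            ≡⟨ ℚ.*-identityʳ a ⟨
    a * 1ℚ       ≡⟨ cong (a *_) rb≡1 ⟨
    a * (r * b)  ≡⟨ ℚ.*-assoc a r b ⟨
    a * r * b    ≤⟨ ℚ.*-monoʳ-≤-nonNeg b {{ℚ.nonNegative (ℚ.<⇒≤ 0<b)}} ar≤n ⟩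
    ι n * b      ∎)
    where open ℚ.≤-Reasoning

  -- Estimates for the detour

  ≡⇒≤ : ∀ {a b : ℚ} → a ≡ b → a ≤ b
  ≡⇒≤ = ℚ.≤-reflexive

  -- Here u and v are the radii of Alice's balls before and after p/q was made a centre, and D is
  -- the length of the detour. The lower bound takes Bob from distance (1 + b/2) v to distance (1 -
  -- 5b/4) v, as 1/2 + 5/4 = 7/4; the upper bound keeps a detour that crosses the centre inside the
  -- ball.
  detour-bounds : ∀ {b u v q m D} →
    0ℚ < b → 0ℚ ≤ v → 0ℚ ≤ q → 0ℚ ≤ m → 0ℚ ≤ D → D * (q * m) ≡ 1ℚ →
    ι 30 * (q * q * (b * v)) ≤ ι 1 →
    ι 4 ≤ m * m * (b * v) → m * m * (b * v) ≤ ι 9 →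
    ι 2 ≤ ι 3 * (u * (q * q)) → ι 10 * (b * u) ≤ ι 21 * v →
    ι 7 * (b * v) ≤ ι 4 * D × ι 25 * D ≤ ι 24 * v
  detour-bounds {b} {u} {v} {q} {m} {D} 0<b 0≤v 0≤q 0≤m 0≤D Dqm≡1 q² m²≥ m²≤ uq² bu =
      lower , upper
    where
    0≤b = ℚ.<⇒≤ 0<b
    -- From 32 q m ≤ 256 q² + m²; the weight 16 balances the bounds 1/30 for q² b v and 9 for m² b
    -- v.
    qmbv : ι 7 * (b * v * (q * m)) ≤ ι 4
    qmbv = lin ((0≤÷ 7 32 ⊗ 0≤b ⊗ 0≤v ⊛ 0≤square (ι 16 * q - m)) ⊕ (0≤÷ 7 32 ⊛ m²≤) ⊕ (0≤÷ 28 15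
          ⊛ q²) ⊕ 0≤÷ 79 480)
        (solve 4 (λ b v q m → # 4 :- # 7 :* (b :* v :* (q :* m))
          := con (7 ÷ 32) :* (b :* v) :* ((# 16 :* q :- m) :* (# 16 :* q :- m)) :+ (con (7 ÷ 32)
            :* # 9 :+ (con (28 ÷ 15) :* # 1 :+ con (79 ÷ 480))) :- (con (7 ÷ 32) :* (b :* v) :*
            # 0 :+ (con (7 ÷ 32) :* (m :* m :* (b :* v)) :+ (con (28 ÷ 15) :* (# 30 :* (q :* q
            :* (b :* v))) :+ # 0)))) refl b v q m)
    lower : ι 7 * (b * v) ≤ ι 4 * D
    lower = lin ((0≤D ⊛ qmbv) ⊕ (0≤ι 7 ⊗ 0≤b ⊗ 0≤v ⊛ ≡⇒≤ (sym Dqm≡1)))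
        (solve 5 (λ b v q m D → # 4 :* D :- # 7 :* (b :* v)
          := D :* # 4 :+ # 7 :* (b :* v) :* (D :* (q :* m)) :- (D :* (# 7 :* (b :* v :* (q :*
            m))) :+ # 7 :* (b :* v) :* # 1)) refl b v q m D)
    X = v * (q * m)
    -- X is v/D. By m² b v ≥ 4 and v ≥ 10 b u/21, its square is at least 40 u q²/21; this is where a
    -- lower bound on u q² is needed.
    X²≥ : (25 ÷ 24) * (25 ÷ 24) ≤ X * X
    X²≥ = *-cancel-≤ 0<b (lin ((0≤v ⊗ 0≤q ⊗ 0≤q ⊛ m²≥) ⊕ (0≤÷ 4 21 ⊗ 0≤q ⊗ 0≤q ⊛ bu) ⊕ (0≤÷ 40
          63 ⊗ 0≤b ⊛ uq²) ⊕ (0≤b ⊛ 0≤÷ 745 4032))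
        (solve 5 (λ b u v q m → b :* (v :* (q :* m) :* (v :* (q :* m))) :- b :* (con (25 ÷ 24)
          :* con (25 ÷ 24))
          := v :* (q :* q) :* (m :* m :* (b :* v)) :+ (con (4 ÷ 21) :* (q :* q) :* (# 21 :* v)
            :+ (con (40 ÷ 63) :* b :* (# 3 :* (u :* (q :* q))) :+ b :* con (745 ÷ 4032))) :- (v
            :* (q :* q) :* # 4 :+ (con (4 ÷ 21) :* (q :* q) :* (# 10 :* (b :* u)) :+
            (con (40 ÷ 63) :* b :* # 2 :+ b :* # 0)))) refl b u v q m))
    upper : ι 25 * D ≤ ι 24 * v
    upper = lin ((0≤ι 24 ⊗ 0≤D ⊛ square-cancel-≤ (0≤v ⊗ 0≤q ⊗ 0≤m) X²≥) ⊕ (0≤ι 24 ⊗ 0≤v ⊛ ≡⇒≤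
          Dqm≡1))
        (solve 4 (λ v q m D → # 24 :* v :- # 25 :* D
          := # 24 :* D :* (v :* (q :* m)) :+ # 24 :* v :* # 1 :- (# 24 :* D :* con (25 ÷ 24) :+
            # 24 :* v :* (D :* (q :* m)))) refl v q m D)

  -- The detour is made in a ball of radius u, and v is the radius of Alice's next ball. Both e and
  -- D are displacements from p/q in the direction of the detour, e that of her new centre and D
  -- that of Bob's. The factor 65/64 bounds 1 + b/2 for b ≤ 1/32.
  record AfterDetour (b u v q m D e : ℚ) : Set where
    field
      0≤b  : 0ℚ ≤ b
      0≤u  : 0ℚ ≤ u
      0≤v  : 0ℚ ≤ v
      0≤q  : 0ℚ ≤ q
      0≤m  : 0ℚ ≤ m
      0≤D  : 0ℚ ≤ D
      Dqm≡1 : D * (q * m) ≡ 1ℚ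
      q²≤  : ι 30 * (q * q * (b * u)) ≤ ι 1
      4≤m² : ι 4 ≤ m * m * (b * u)
      m²≤9 : m * m * (b * u) ≤ ι 9
      v≤bu : ι 200 * v ≤ ι 103 * (b * u)
      bu≤v : ι 10 * (b * u) ≤ ι 21 * v
      e≤   : e - D ≤ (65 ÷ 64) * v
      e≥   : D - e ≤ (65 ÷ 64) * v

  module _ {b u v q m D e : ℚ} (R : AfterDetour b u v q m D e) where
    open AfterDetour R
    -- e = |z − p/q| for the centre z of Alice's ball, and 1/(q q′) has to fall into
    -- the window [f − 19v/10, f].  With F = q f this holds as soon as
    -- (q′ − q) F ≤ 1 ≤ q′ F, which every residue class mod q meets.
    f = e + (19 ÷ 20) * v
    F = q * f
    q²v : ι 6000 * (q * q * v) ≤ ι 103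
    q²v = lin ((0≤ι 30 ⊗ 0≤q ⊗ 0≤q ⊛ v≤bu) ⊕ (0≤ι 103 ⊛ q²≤))
        (solve 4 (λ b u v q → # 103 :- # 6000 :* (q :* q :* v)
          := # 30 :* (q :* q) :* (# 103 :* (b :* u)) :+ # 103 :* # 1 :- (# 30 :* (q :* q) :*
            (# 200 :* v) :+ # 103 :* (# 30 :* (q :* q :* (b :* u))))) refl b u v q)
    m²v : ι 200 * (m * m * v) ≤ ι 927
    m²v = lin ((0≤m ⊗ 0≤m ⊛ v≤bu) ⊕ (0≤ι 103 ⊛ m²≤9))
        (solve 4 (λ b u v m → # 927 :- # 200 :* (m :* m :* v)
          := m :* m :* (# 103 :* (b :* u)) :+ # 103 :* # 9 :- (m :* m :* (# 200 :* v) :+ # 103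
            :* (m :* m :* (b :* u)))) refl b u v m)
    qmv : ι 25 * (q * m * v) ≤ ι 8
    qmv = lin ((0≤÷ 5 4 ⊗ 0≤v ⊛ 0≤square (ι 10 * q - m)) ⊕ (0≤÷ 1 48 ⊛ q²v) ⊕ (0≤÷ 1 160 ⊛ m²v)
          ⊕ 0≤÷ 29 480)
        (solve 3 (λ q m v → # 8 :- # 25 :* (q :* m :* v)
          := con (5 ÷ 4) :* v :* ((# 10 :* q :- m) :* (# 10 :* q :- m)) :+ (con (1 ÷ 48) :*
            # 103 :+ (con (1 ÷ 160) :* # 927 :+ con (29 ÷ 480))) :- (con (5 ÷ 4) :* v :* # 0 :+
            (con (1 ÷ 48) :* (# 6000 :* (q :* q :* v)) :+ (con (1 ÷ 160) :* (# 200 :* (m :* m :*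
            v)) :+ # 0)))) refl q m v)
    f≤ : f ≤ D + ι 2 * v
    f≤ = lin (e≤ ⊕ (0≤÷ 11 320 ⊛ 0≤v))
        (solve 3 (λ D e v → D :+ # 2 :* v :- (e :+ con (19 ÷ 20) :* v)
          := con (65 ÷ 64) :* v :+ con (11 ÷ 320) :* v :- (e :- D :+ con (11 ÷ 320) :*
            # 0)) refl D e v)
    f≥ : D - (1 ÷ 10) * v ≤ f
    f≥ = lin (e≥ ⊕ (0≤÷ 11 320 ⊛ 0≤v))
        (solve 3 (λ D e v → e :+ con (19 ÷ 20) :* v :- (D :- con (1 ÷ 10) :* v)
          := con (65 ÷ 64) :* v :+ con (11 ÷ 320) :* v :- (D :- e :+ con (11 ÷ 320) :*
            # 0)) refl D e v)
    mF≥ : 9 ÷ 10 ≤ m * F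
    mF≥ = lin ((0≤q ⊗ 0≤m ⊛ f≥) ⊕ (0≤÷ 1 250 ⊛ qmv) ⊕ ≡⇒≤ (sym Dqm≡1) ⊕ 0≤÷ 17 250)
        (solve 5 (λ q m D e v → m :* (q :* (e :+ con (19 ÷ 20) :* v)) :- con (9 ÷ 10)
          := q :* m :* (e :+ con (19 ÷ 20) :* v) :+ (con (1 ÷ 250) :* # 8 :+ (D :* (q :* m) :+
            con (17 ÷ 250))) :- (q :* m :* (D :- con (1 ÷ 10) :* v) :+ (con (1 ÷ 250) :* (# 25
            :* (q :* m :* v)) :+ (# 1 :+ # 0)))) refl q m D e v)
    mF≤ : m * F ≤ 41 ÷ 25
    mF≤ = lin ((0≤q ⊗ 0≤m ⊛ f≤) ⊕ (0≤÷ 2 25 ⊛ qmv) ⊕ ≡⇒≤ Dqm≡1)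
        (solve 5 (λ q m D e v → con (41 ÷ 25) :- m :* (q :* (e :+ con (19 ÷ 20) :* v))
          := q :* m :* (D :+ # 2 :* v) :+ (con (2 ÷ 25) :* # 8 :+ # 1) :- (q :* m :* (e :+
            con (19 ÷ 20) :* v) :+ (con (2 ÷ 25) :* (# 25 :* (q :* m :* v)) :+ D :* (q :*
            m)))) refl q m D e v)
    0<F : 0ℚ < F
    0<F = ℚ.≰⇒> λ F≤0 → <⇒≱ (ℚ.positive⁻¹ (9 ÷ 10))
      (lin (mF≥ ⊕ (0≤m ⊛ F≤0))
          (solve 4 (λ m q e v → # 0 :- con (9 ÷ 10)
            := m :* (q :* (e :+ con (19 ÷ 20) :* v)) :+ m :* # 0 :- (con (9 ÷ 10) :+ m :* (q :*
              (e :+ con (19 ÷ 20) :* v)))) refl m q e v))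
    -- Since q D = 1/m, this is `4≤m²` in another form.
    μ²≤ : ι 4 * (q * D * (q * D)) ≤ b * u
    μ²≤ = lin ((0≤q*D ⊗ 0≤q*D ⊛ 4≤m²) ⊕ ((0≤b ⊗ 0≤u) ⊗ 0≤s ⊛ ≡⇒≤ Dqm≡1))
        (solve 5 (λ b u q m D → b :* u :- # 4 :* (q :* D :* (q :* D))
          := q :* D :* (q :* D) :* (m :* m :* (b :* u)) :+ b :* u :* (D :* (q :* m) :+ # 1) :*
            # 1 :- (q :* D :* (q :* D) :* # 4 :+ b :* u :* (D :* (q :* m) :+ # 1) :* (D :* (q :*
            m)))) refl b u q m D)
      where
      0≤q*D = 0≤q ⊗ 0≤D
      0≤s : 0ℚ ≤ D * (q * m) + ι 1
      0≤s = (0≤D ⊗ 0≤q ⊗ 0≤m) ⊕ 0≤ι 1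
    -- The two conditions on q′ give f - 1/(q q′) ≤ F/q′ ≤ F². So this bound, being below 19v/10,
    -- says that the fractions lie densely enough to meet the window.
    F²≤ : F * F ≤ (6 ÷ 5) * v
    F²≤ = begin
      F * F   ≤⟨ ℚ.<⇒≤ 0<F ⊛ F≤G ⟩
      F * G   ≡⟨ ℚ.*-comm F G ⟩
      G * F   ≤⟨ ℚ.≤-trans (ℚ.<⇒≤ 0<F) F≤G ⊛ F≤G ⟩
      G * G   ≤⟨ (lin (0≤square (q * D - ι 2 * (q * v)) ⊕ (0≤÷ 1 2 ⊛ μ²≤) ⊕ (0≤÷ 1 20 ⊛ bu≤v) ⊕
            (0≤÷ 1 750 ⊗ 0≤v ⊛ q²v) ⊕ (0≤÷ 19 1500 ⊛ 0≤v))
          (solve 5 (λ b u v q D → con (6 ÷ 5) :* v :- q :* (D :+ # 2 :* v) :* (q :* (D :+ # 2 :*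
            v))
            := (q :* D :- # 2 :* (q :* v)) :* (q :* D :- # 2 :* (q :* v)) :+ (con (1 ÷ 2) :* (b
              :* u) :+ (con (1 ÷ 20) :* (# 21 :* v) :+ (con (1 ÷ 750) :* v :* # 103 :+
              con (19 ÷ 1500) :* v))) :- (# 0 :+ (con (1 ÷ 2) :* (# 4 :* (q :* D :* (q :* D)))
              :+ (con (1 ÷ 20) :* (# 10 :* (b :* u)) :+ (con (1 ÷ 750) :* v :* (# 6000 :* (q :*
              q :* v)) :+ con (19 ÷ 1500) :* # 0))))) refl b u v q D)) ⟩
      (6 ÷ 5) * v ∎
      where
      open ℚ.≤-Reasoning
      G = q * (D + ι 2 * v)
      F≤G : F ≤ G
      F≤G = 0≤q ⊛ f≤
    module _ {q′ E : ℚ} (0≤q′ : 0ℚ ≤ q′) (0≤E : 0ℚ ≤ E) (Eqq′ : E * (q * q′) ≡ 1ℚ)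
      (q′F≥1 : 1ℚ ≤ q′ * F) (q′F≤ : (q′ - q) * F ≤ 1ℚ) where
      close≤ : E - e ≤ (19 ÷ 20) * v
      close≤ = lin ((0≤E ⊛ q′F≥1) ⊕ ≡⇒≤ (cong (λ t → t * f) Eqq′))
          (solve 5 (λ q q′ e v E → con (19 ÷ 20) :* v :- (E :- e)
            := E :* (q′ :* (q :* (e :+ con (19 ÷ 20) :* v))) :+ # 1 :* (e :+ con (19 ÷ 20) :* v)
              :- (E :* # 1 :+ E :* (q :* q′) :* (e :+ con (19 ÷ 20) :* v))) refl q q′ e v E)
      F≤q′v : F ≤ (6 ÷ 5) * (v * q′)
      F≤q′v = lin ((ℚ.<⇒≤ 0<F ⊛ q′F≥1) ⊕ (0≤q′ ⊛ F²≤))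
          (solve 3 (λ F q′ v → con (6 ÷ 5) :* (v :* q′) :- F
            := F :* (q′ :* F) :+ q′ :* (con (6 ÷ 5) :* v) :- (F :* # 1 :+ q′ :* (F :*
              F))) refl F q′ v)
      close≥ : e - E ≤ (19 ÷ 20) * v
      close≥ = lin ((0≤E ⊛ q′F≤) ⊕ (0≤E ⊗ 0≤q ⊛ F≤q′v) ⊕ ≡⇒≤ (sym (cong (λ t → t * f) Eqq′)) ⊕
            (0≤÷ 6 5 ⊗ 0≤v ⊛ ≡⇒≤ Eqq′) ⊕ (0≤÷ 7 10 ⊛ 0≤v))
          (solve 5 (λ q q′ e v E → con (19 ÷ 20) :* v :- (e :- E)
            := E :* # 1 :+ (E :* q :* (con (6 ÷ 5) :* (v :* q′)) :+ (E :* (q :* q′) :* (e :+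
              con (19 ÷ 20) :* v) :+ (con (6 ÷ 5) :* v :* # 1 :+ con (7 ÷ 10) :* v))) :- (E :*
              ((q′ :- q) :* (q :* (e :+ con (19 ÷ 20) :* v))) :+ (E :* q :* (q :* (e :+
              con (19 ÷ 20) :* v)) :+ (# 1 :* (e :+ con (19 ÷ 20) :* v) :+ (con (6 ÷ 5) :* v :*
              (E :* (q :* q′)) :+ con (7 ÷ 10) :* # 0))))) refl q q′ e v E)
      vq′²≥ : ι 2 ≤ ι 3 * (v * (q′ * q′))
      vq′²≥ = lin ((0≤÷ 5 2 ⊗ ((0≤q′ ⊗ ℚ.<⇒≤ 0<F) ⊕ 0≤ι 1) ⊛ q′F≥1) ⊕ (0≤÷ 5 2 ⊗ 0≤q′ ⊗ 0≤q′ ⊛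
            F²≤) ⊕ 0≤÷ 1 2)
          (solve 3 (λ F q′ v → # 3 :* (v :* (q′ :* q′)) :- # 2
            := con (5 ÷ 2) :* (q′ :* F :+ # 1) :* (q′ :* F) :+ (con (5 ÷ 2) :* (q′ :* q′) :*
              (con (6 ÷ 5) :* v) :+ con (1 ÷ 2)) :- (con (5 ÷ 2) :* (q′ :* F :+ # 1) :* # 1 :+
              (con (5 ÷ 2) :* (q′ :* q′) :* (F :* F) :+ # 0))) refl F q′ v)
      -- From q′ m F ≤ m + q (m F), where m F lies between 9/10 and 41/25: q′ is at most of the
      -- order of m, which bounds v q′².
      q′≤ : (9 ÷ 10) * q′ ≤ m + (41 ÷ 25) * q
      q′≤ = lin ((0≤q′ ⊛ mF≥) ⊕ (0≤m ⊛ q′F≤) ⊕ (0≤q ⊛ mF≤))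
          (solve 4 (λ m F q q′ → m :+ con (41 ÷ 25) :* q :- con (9 ÷ 10) :* q′
            := q′ :* (m :* F) :+ (m :* # 1 :+ q :* con (41 ÷ 25)) :- (q′ :* con (9 ÷ 10) :+ (m
              :* ((q′ :- q) :* F) :+ q :* (m :* F)))) refl m F q q′)
      vq′²≤ : v * (q′ * q′) ≤ ι 17
      vq′²≤ = lin ((0≤÷ 10 9 ⊗ 0≤v ⊗ 0≤q′ ⊛ q′≤) ⊕ (0≤÷ 100 81 ⊗ 0≤v ⊗ (0≤m ⊕ 0≤÷ 41 25 ⊗ 0≤q) ⊛
            q′≤) ⊕ (0≤÷ 100 81 ⊗ 0≤v ⊛ 0≤square (m - (41 ÷ 25) * q)) ⊕ (0≤÷ 1 81 ⊛ m²v) ⊕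
            (0≤÷ 1681 1518750 ⊛ q²v) ⊕ 0≤÷ 8264357 1518750)
          (solve 4 (λ v m q q′ → # 17 :- v :* (q′ :* q′)
            := con (10 ÷ 9) :* (v :* q′) :* (m :+ con (41 ÷ 25) :* q) :+ (con (100 ÷ 81) :* (v
              :* (m :+ con (41 ÷ 25) :* q)) :* (m :+ con (41 ÷ 25) :* q) :+ (con (100 ÷ 81) :* v
              :* ((m :- con (41 ÷ 25) :* q) :* (m :- con (41 ÷ 25) :* q)) :+ (con (1 ÷ 81) :*
              # 927 :+ (con (1681 ÷ 1518750) :* # 103 :+ con (8264357 ÷ 1518750))))) :-
              (con (10 ÷ 9) :* (v :* q′) :* (con (9 ÷ 10) :* q′) :+ (con (100 ÷ 81) :* (v :* (m
              :+ con (41 ÷ 25) :* q)) :* (con (9 ÷ 10) :* q′) :+ (con (100 ÷ 81) :* v :* # 0 :+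
              (con (1 ÷ 81) :* (# 200 :* (m :* m :* v)) :+ (con (1681 ÷ 1518750) :* (# 6000 :*
              (q :* q :* v)) :+ # 0)))))) refl v m q q′)

  -- Targets and detours

  unit : Bool → ℤ
  unit true  = + 1
  unit false = -[1+ 0 ]

  sgn : Bool → ℚ
  sgn s = fromℤ (unit s)

  ∣unit∣ : ∀ s → ℤ.∣ unit s ∣ ≡ 1
  ∣unit∣ true  = refl
  ∣unit∣ false = refl

  sgn² : ∀ s → sgn s * sgn s ≡ 1ℚ
  sgn² true  = refl
  sgn² false = refl

  ∣sgn*∣ : ∀ s a → ∣ sgn s * a ∣ ≡ ∣ a ∣
  ∣sgn*∣ true  a = cong ∣_∣ (ℚ.*-identityˡ a)
  ∣sgn*∣ false a = trans (cong ∣_∣ (solve 1 (λ a → :- # 1 :* a := :- a) refl a)) (ℚ.∣-p∣≡∣p∣ a)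

  den : ℚ → ℚ
  den y = ι (↧ₙ y)

  -- z and u approximate the centre and the radius of a ball of Alice, and b
  -- approximates β.  A ball of radius β times hers around a deep point is legal for
  -- Bob; 5b/4 instead of β makes up for the errors of the approximations.
  Deep : (b z u c : ℚ) → Set
  Deep b z u c = ∣ c - z ∣ ≤ (ι 1 - (5 ÷ 4) * b) * u

  -- For U = 1/17 a ball of Bob around y = p/q stays within 18β/q² of y; for
  -- U = 16b² the denominator may be larger, and y only prepares a detour.
  record Target (U b z u y : ℚ) : Set where
    constructor target
    field
      deep  : Deep b z u y
      large : ι 2 ≤ ι 3 * (u * (den y * den y))
      small : U * (u * (den y * den y)) ≤ ι 1

  abstract
    offset : ℚ → ℕ → ℚ
    offset y n = 1 ÷ suc (↧ₙ y ℕ.* suc n ℕ.∸ 1)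

    offset-* : ∀ y n → offset y n * (den y * ι (suc n)) ≡ 1ℚ
    offset-* y@record{} n = trans (cong (λ t → offset y n * t) (sym (ι-* (↧ₙ y) (suc n))))
        (1÷-* (↧ₙ y ℕ.* suc n))

    0≤offset : ∀ y n → 0ℚ ≤ offset y n
    0≤offset y n = 0≤÷ 1 (suc (↧ₙ y ℕ.* suc n ℕ.∸ 1))

  aside : ℚ → ℕ → Bool → ℚ
  aside y n s = y + sgn s * offset y n

  -- At distance 1/(q m) from p/q the fractions p′/q′ with p′q − p q′ = ±1 have
  -- q′ ≈ m and gaps of about 1/m².  The bounds on m make these gaps comparable with
  -- b u / 2, the radius of the next ball of Alice.
  record Detour (b z u y : ℚ) (n : ℕ) (s : Bool) : Set where
    constructor detour
    field
      deep : Deep b z u (aside y n s)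
      q²≤  : ι 30 * (den y * den y * (b * u)) ≤ ι 1
      4≤m² : ι 4 ≤ ι (suc n) * ι (suc n) * (b * u)
      m²≤9 : ι (suc n) * ι (suc n) * (b * u) ≤ ι 9

  cross-fromℤ : ∀ a b c d {e} → a ℤ.* b ℤ.- c ℤ.* d ≡ e →
    fromℤ a * fromℤ b - fromℤ c * fromℤ d ≡ fromℤ e
  cross-fromℤ a b c d eq = trans (sym (cong₂ _-_ (fromℤ-* a b) (fromℤ-* c d)))
    (trans (sym (fromℤ-- (a ℤ.* b) (c ℤ.* d))) (cong fromℤ eq))

  cross-multiply : ∀ {x y a b p p′} → x * b ≡ p′ → y * a ≡ p →
    (x - y) * (a * b) ≡ p′ * a - p * b
  cross-multiply {x} {y} {a} {b} eq′ eq = trans (solve 4 (λ x y a b → (x :- y) :* (a :* b)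
        := x :* b :* a :- y :* a :* b) refl x y a b)
    (cong₂ (λ t t′ → t * a - t′ * b) eq′ eq)

  difference-*-≤1 : ∀ {x a F} → 0ℚ ≤ F → x ≤ a → (x - a) * F ≤ 1ℚ
  difference-*-≤1 {x} {a} {F} 0≤F x≤a = lin ((0≤F ⊛ x≤a) ⊕ 0≤÷ 1 1)
      (solve 3 (λ x a F → # 1 :- (x :- a) :* F
        := F :* a :+ con (1 ÷ 1) :- (F :* x :+ # 0)) refl x a F)

  sum-difference-*-≤1 : ∀ {a x F} → x * F ≤ 1ℚ → (a + x - a) * F ≤ 1ℚ
  sum-difference-*-≤1 {a} {x} {F} p = lin (p)
      (solve 3 (λ x a F → # 1 :- (a :+ x :- a) :* F := # 1 :- x :* F) refl x a F)

  abstract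
    -- The admissible q′ form a residue class modulo q. One is taken that satisfies q′F ≥ 1 while
    -- its predecessor in the class, if positive, does not.
    neighbour : ∀ y s F → 0ℚ < F → ∃ λ y′ →
      (y′ - y) * (den y * den y′) ≡ sgn s × 1ℚ ≤ den y′ * F × (den y′ - den y) * F ≤ 1ℚ
    neighbour y@(mkℚ p q-1 c) s F 0<F =
      let p₀ , r , r<q , cross = cross-difference p q (Coprime.recompute c) (unit s)
          K , 1≤KF = archimedean 1ℚ F 0<F
          k , F≥1 , least-k = least (λ k → 1ℚ ℚ.≤? ι (suc (k ℕ.* q ℕ.+ r)) * F) K
              (K-large K r 1≤KF)
          cross′ = cross-difference-shift p q p₀ r k cross
          y′ = mkℚ (+ k ℤ.* p ℤ.+ p₀) (k ℕ.* q ℕ.+ r)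
            (cross-difference⇒coprime p q (+ k ℤ.* p ℤ.+ p₀) (suc (k ℕ.* q ℕ.+ r))
                (∣unit∣ s) cross′)
      in y′
        , trans (cross-multiply {y′} {y} {ι q} {den y′} (*-↧ y′) (*-↧ y))
            (cross-fromℤ (+ k ℤ.* p ℤ.+ p₀) (+ q) p (+ suc (k ℕ.* q ℕ.+ r)) cross′)
        , F≥1 , upper r<q k least-k
      where
      q : ℕ
      q = suc q-1
      K-large : ∀ K r → 1ℚ ≤ ι K * F → 1ℚ ≤ ι (suc (K ℕ.* q ℕ.+ r)) * F
      K-large K r 1≤KF = ℚ.≤-trans 1≤KF
        (ℚ.*-monoʳ-≤-nonNeg F {{ℚ.nonNegative (ℚ.<⇒≤ 0<F)}} (ι-mono-≤
          (ℕ.≤-trans (ℕ.m≤m*n K q) (ℕ.≤-trans (ℕ.m≤m+n (K ℕ.* q) r) (ℕ.n≤1+n _)))))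
      upper : ∀ {r} → r ℕ.< q → ∀ k → (∀ j → k ≡ suc j → ¬ (1ℚ ≤ ι (suc (j ℕ.* q ℕ.+ r)) * F)) →
        (ι (suc (k ℕ.* q ℕ.+ r)) - ι q) * F ≤ 1ℚ
      -- There is no positive predecessor, but q′ = r + 1 ≤ q makes the left side nonpositive.
      upper r<q zero    _ = difference-*-≤1 (ℚ.<⇒≤ 0<F) (ι-mono-≤ r<q)
      upper {r} r<q (suc j) l = subst (λ t → (t - ι q) * F ≤ 1ℚ) (sym (split j))
        (sum-difference-*-≤1 {ι q} {ι (suc (j ℕ.* q ℕ.+ r))} {F} (ℚ.<⇒≤ (ℚ.≰⇒> (l j refl))))
        where
        split : ∀ j → ι (suc (suc j ℕ.* q ℕ.+ r)) ≡ ι q + ι (suc (j ℕ.* q ℕ.+ r))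
        split j = trans (cong ι (trans (cong suc (ℕ.+-assoc q (j ℕ.* q) r))
          (sym (ℕ.+-suc q (j ℕ.* q ℕ.+ r))))) (ι-+ q (suc (j ℕ.* q ℕ.+ r)))

  ∣∣≤⇒sgn*≤ : ∀ s {a c} → ∣ a ∣ ≤ c → sgn s * a ≤ c
  ∣∣≤⇒sgn*≤ s {a} p = ∣∣≤⇒≤ (subst (_≤ _) (sym (∣sgn*∣ s a)) p)

  ∣∣≤⇒-sgn*≤ : ∀ s {a c} → ∣ a ∣ ≤ c → - (sgn s * a) ≤ c
  ∣∣≤⇒-sgn*≤ s {a} p = ∣∣≤⇒-≤ (subst (_≤ _) (sym (∣sgn*∣ s a)) p)

  -- What is known after Bob has played a ball about y and Alice has answered. Her radius is about b
  -- u/2. As her ball has half the radius of his, her centre is at most about one radius of hers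
  -- away from y; b/2 collects the errors.
  record Step (b u y z′ u′ : ℚ) : Set where
    field
      0<u′  : 0ℚ < u′
      near  : ∣ z′ - y ∣ ≤ (ι 1 + (1 ÷ 2) * b) * u′
      u′≤bu : ι 200 * u′ ≤ ι 103 * (b * u)
      bu≤u′ : ι 10 * (b * u) ≤ ι 21 * u′

  detour⇒target : ∀ {b z u y n s z′ u′} → 0ℚ < b → ι 32 * b ≤ ι 1 → 0ℚ < u →
    Detour b z u y n s → Step b u (aside y n s) z′ u′ → ∃ (Target (1 ÷ 17) b z′ u′)
  detour⇒target {b} {_} {u} {y} {n} {s} {z′} {u′} 0<b b≤ 0<u det st =
      y′ , target deep′ vq′²≥′ small′
    where
    open Step st
    q = den y
    m = ι (suc n)
    D = offset y n
    g = sgn s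
    -- The factor g turns a detour to the left into one to the right.
    e = g * (z′ - y)
    0≤v = ℚ.<⇒≤ 0<u′
    z-c≤ : ∣ z′ - aside y n s ∣ ≤ (65 ÷ 64) * u′
    z-c≤ = ℚ.≤-trans near (lin ((0≤÷ 1 64 ⊗ 0≤v ⊛ b≤))
        (solve 2 (λ b v → con (65 ÷ 64) :* v :- (# 1 :+ con (1 ÷ 2) :* b) :* v
          := con (1 ÷ 64) :* v :* # 1 :- con (1 ÷ 64) :* v :* (# 32 :* b)) refl b v))
      where v = u′
    z-c≡ : g * (z′ - aside y n s) ≡ e - D
    z-c≡ = trans (solve 4 (λ g z y D → g :* (z :- (y :+ g :* D))
          := g :* (z :- y) :- g :* g :* D) refl g z y D)
              (cong (λ t → e - t) (trans (cong (_* D) (sgn² s)) (ℚ.*-identityˡ D)))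
      where z = z′
    R : AfterDetour b u u′ q m D e
    R = record
      { 0≤b = ℚ.<⇒≤ 0<b ; 0≤u = ℚ.<⇒≤ 0<u ; 0≤v = 0≤v
      ; 0≤q = 0≤ι _ ; 0≤m = 0≤ι (suc n) ; 0≤D = 0≤offset y n ; Dqm≡1 = offset-* y n
      ; q²≤ = Detour.q²≤ det ; 4≤m² = Detour.4≤m² det ; m²≤9 = Detour.m²≤9 det
      ; v≤bu = u′≤bu ; bu≤v = bu≤u′
      ; e≤ = subst (_≤ _) z-c≡ (∣∣≤⇒sgn*≤ s z-c≤)
      ; e≥ = subst (_≤ _) (trans (cong -_ z-c≡) (solve 2 (λ e D → :- (e :- D)
            := D :- e) refl e D)) (∣∣≤⇒-sgn*≤ s z-c≤) }
    nb = neighbour y s (F R) (0<F R)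
    y′ = proj₁ nb
    q′ = den y′
    E-r = reciprocal (q * q′) (0<⊗ (0<ι↧ y) (0<ι↧ y′))
    E = proj₁ E-r
    0≤E = ℚ.<⇒≤ (proj₁ (proj₂ E-r))
    Eqq′ = proj₂ (proj₂ E-r)
    0≤q′ : 0ℚ ≤ q′
    0≤q′ = 0≤ι _
    q′F≥1 = proj₁ (proj₂ (proj₂ nb))
    q′F≤  = proj₂ (proj₂ (proj₂ nb))
    y′-y≡ : y′ - y ≡ g * E
    y′-y≡ = begin
      y′ - y                    ≡⟨ ℚ.*-identityʳ (y′ - y) ⟨
      (y′ - y) * 1ℚ             ≡⟨ cong ((y′ - y) *_) Eqq′ ⟨
      (y′ - y) * (E * (q * q′)) ≡⟨ (let x = y′ - y; a = q * q′ in (solve 3 (λ x E a → x :* (E :*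
            a)
            := x :* a :* E) refl x E a)) ⟩
      (y′ - y) * (q * q′) * E   ≡⟨ cong (_* E) (proj₁ (proj₂ nb)) ⟩
      g * E ∎
      where open ≡-Reasoning
    y′-z′≡ : y′ - z′ ≡ g * (E - e)
    y′-z′≡ = begin
      y′ - z′                      ≡⟨ (let a = y′; c = z′ in (solve 3 (λ a c y → a :- c
            := a :- y :- (c :- y)) refl a c y)) ⟩
      (y′ - y) - (z′ - y)          ≡⟨ cong₂ _-_ y′-y≡
          (trans (sym (ℚ.*-identityˡ (z′ - y))) (cong (_* (z′ - y)) (sym (sgn² s)))) ⟩
      g * E - g * g * (z′ - y)     ≡⟨ (let c = z′ in (solve 4 (λ g E c y → g :* E :- g :* g :*
            (c :- y)
            := g :* (E :- g :* (c :- y))) refl g E c y)) ⟩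
      g * (E - e) ∎
      where open ≡-Reasoning
    deep′ : Deep b z′ u′ y′
    deep′ = begin
      ∣ y′ - z′ ∣      ≡⟨ trans (cong ∣_∣ y′-z′≡) (∣sgn*∣ s (E - e)) ⟩
      ∣ E - e ∣        ≤⟨ ≤⇒∣∣≤ (close≤ R 0≤q′ 0≤E Eqq′ q′F≥1 q′F≤)
          (subst (_≤ _) (solve 2 (λ e E →
            e :- E
            := :- (E :- e)) refl e E) (close≥ R 0≤q′ 0≤E Eqq′ q′F≥1 q′F≤)) ⟩
      (19 ÷ 20) * u′   ≤⟨ (lin ((0≤÷ 5 128 ⊗ 0≤v ⊛ b≤) ⊕ (0≤÷ 7 640 ⊛ 0≤v))
          (solve 2 (λ b v → (# 1 :- con (5 ÷ 4) :* b) :* v :- con (19 ÷ 20) :* v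
            := con (5 ÷ 128) :* v :* # 1 :+ con (7 ÷ 640) :* v :- (con (5 ÷ 128) :* v :* (# 32
              :* b) :+ con (7 ÷ 640) :* # 0)) refl b v)) ⟩
      (ι 1 - (5 ÷ 4) * b) * u′ ∎
      where
      open ℚ.≤-Reasoning
      v = u′
    vq′²≥′ = vq′²≥ R 0≤q′ 0≤E Eqq′ q′F≥1 q′F≤
    small′ : (1 ÷ 17) * (u′ * (q′ * q′)) ≤ ι 1
    small′ = lin ((0≤÷ 1 17 ⊛ vq′²≤ R 0≤q′ 0≤E Eqq′ q′F≥1 q′F≤))
        (solve 1 (λ x → # 1 :- con (1 ÷ 17) :* x
          := con (1 ÷ 17) :* # 17 :- con (1 ÷ 17) :* x) refl x)
      where x = u′ * (q′ * q′)

  -- Here m = `suc n` is stopped as m²w reaches 4. For its predecessor a, the inequality (a + 1)² ≤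
  -- 5a²/4 + 5 and the smallness of w prevent a jump beyond 9.
  square-scale : ∀ w → 0ℚ < w → ι 100 * w ≤ ι 1 → ∃ λ n →
    ι 4 ≤ ι (suc n) * ι (suc n) * w × ι (suc n) * ι (suc n) * w ≤ ι 9
  square-scale w 0<w w≤ =
    let K , 4≤Kw = archimedean (ι 4) w 0<w
        n , 4≤n²w , l = least (λ n → ι 4 ℚ.≤? ι (suc n) * ι (suc n) * w) K (K-large K 4≤Kw)
    in n , 4≤n²w , upper n l
    where
    0≤w = ℚ.<⇒≤ 0<w
    K-large : ∀ K → ι 4 ≤ ι K * w → ι 4 ≤ ι (suc K) * ι (suc K) * w
    K-large K 4≤Kw = ℚ.≤-trans 4≤Kw (enlarge (ι K) {ι (suc K)} (0≤ι K) (ι-+ 1 K))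
      where
      enlarge : ∀ a {c} → 0ℚ ≤ a → c ≡ ι 1 + a → a * w ≤ c * c * w
      enlarge a 0≤a refl = lin ((((0≤ι 1 ⊕ 0≤a) ⊕ (0≤a ⊗ 0≤a)) ⊗ 0≤w ⊛ 0≤ι 1))
          (solve 2 (λ a w → (# 1 :+ a) :* (# 1 :+ a) :* w :- a :* w
            := (# 1 :+ a :+ a :* a) :* w :* # 1 :- (# 1 :+ a :+ a :* a) :* w :* # 0) refl a w)
    upper : ∀ n → (∀ k → n ≡ suc k → ¬ (ι 4 ≤ ι (suc k) * ι (suc k) * w)) →
      ι (suc n) * ι (suc n) * w ≤ ι 9
    upper zero    _ = ℚ.≤-trans (ℚ.≤-reflexive (ℚ.*-identityˡ w))
      (lin ((0≤÷ 1 100 ⊛ w≤) ⊕ 0≤÷ 899 100)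
          (solve 1 (λ w → # 9 :- w
            := con (1 ÷ 100) :* # 1 :+ con (899 ÷ 100) :- (con (1 ÷ 100) :* (# 100 :* w) :+
              # 0)) refl w))
    upper (suc k) l = next (ι (suc k)) {ι (suc (suc k))} (ι-+ 1 (suc k))
        (ℚ.<⇒≤ (ℚ.≰⇒> (l k refl)))
      where
      next : ∀ a {c} → c ≡ ι 1 + a → a * a * w ≤ ι 4 → c * c * w ≤ ι 9
      next a refl h = lin ((0≤÷ 5 4 ⊛ h) ⊕ (0≤w ⊛ 0≤square ((1 ÷ 2) * a - ι 2)) ⊕ (0≤÷ 5 100 ⊛
            w≤) ⊕ 0≤÷ 79 20)
          (solve 2 (λ a w → # 9 :- (# 1 :+ a) :* (# 1 :+ a) :* w
            := con (5 ÷ 4) :* # 4 :+ (w :* ((con (1 ÷ 2) :* a :- # 2) :* (con (1 ÷ 2) :* a :-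
              # 2)) :+ (con (5 ÷ 100) :* # 1 :+ con (79 ÷ 20))) :- (con (5 ÷ 4) :* (a :* a :* w)
              :+ (w :* # 0 :+ (con (5 ÷ 100) :* (# 100 :* w) :+ # 0)))) refl a w)

  target⇒detour : ∀ {b z u y z′ u′} → 0ℚ < b → ι 32 * b ≤ ι 1 → 0ℚ < u → u ≤ ι 1 →
    Target (ι 16 * (b * b)) b z u y → Step b u y z′ u′ → ∃₂ (Detour b z′ u′ y)
  target⇒detour {b} {_} {u} {y} {z′} {u′} 0<b b≤ 0<u u≤1 tar st =
    let n , 4≤m² , m²≤9 = square-scale (b * u′) (0<⊗ 0<b 0<u′) bu′≤
        s , deep = direction n (ℚ.≤-total 0ℚ (y - z′))
                     (detour-bounds 0<b 0≤v 0≤q (0≤ι (suc n)) (0≤offset y n) (offset-* y n)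
                       q² 4≤m² m²≤9 (Target.large tar) bu≤u′)
    in n , s , detour deep q² 4≤m² m²≤9
    where
    open Step st
    q = den y
    v = u′
    0≤q : 0ℚ ≤ q
    0≤q = 0≤ι (↧ₙ y)
    0≤b = ℚ.<⇒≤ 0<b
    0≤v = ℚ.<⇒≤ 0<u′
    bu′≤ : ι 100 * (b * u′) ≤ ι 1
    bu′≤ = lin ((0≤÷ 1 2 ⊗ 0≤b ⊛ u′≤bu) ⊕ (0≤÷ 103 2 ⊗ 0≤b ⊗ 0≤b ⊛ u≤1) ⊕ (0≤÷ 103 64 ⊗ 0≤b ⊛
          b≤) ⊕ (0≤÷ 103 2048 ⊛ b≤) ⊕ 0≤÷ 1945 2048)
        (solve 3 (λ b u v → # 1 :- # 100 :* (b :* v)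
          := con (1 ÷ 2) :* b :* (# 103 :* (b :* u)) :+ (con (103 ÷ 2) :* (b :* b) :* # 1 :+
            (con (103 ÷ 64) :* b :* # 1 :+ (con (103 ÷ 2048) :* # 1 :+ con (1945 ÷ 2048)))) :-
            (con (1 ÷ 2) :* b :* (# 200 :* v) :+ (con (103 ÷ 2) :* (b :* b) :* u :+
            (con (103 ÷ 64) :* b :* (# 32 :* b) :+ (con (103 ÷ 2048) :* (# 32 :* b) :+
            # 0))))) refl b u v)
    -- This is the reason for 16 in U = 16b²: u′ ≤ 103 b u/200, and 103/(200 · 16) is below 1/30.
    q² : ι 30 * (q * q * (b * u′)) ≤ ι 1
    q² = lin ((0≤÷ 3 20 ⊗ (0≤q ⊗ 0≤q) ⊗ 0≤b ⊛ u′≤bu) ⊕ (0≤÷ 309 320 ⊛ Target.small tar) ⊕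
          0≤÷ 11 320)
        (solve 4 (λ b u v q → # 1 :- # 30 :* (q :* q :* (b :* v))
          := con (3 ÷ 20) :* (q :* q :* b) :* (# 103 :* (b :* u)) :+ (con (309 ÷ 320) :* # 1 :+
            con (11 ÷ 320)) :- (con (3 ÷ 20) :* (q :* q :* b) :* (# 200 :* v) :+
            (con (309 ÷ 320) :* (# 16 :* (b :* b) :* (u :* (q :* q))) :+ # 0))) refl b u v q)
    -- The detour goes towards the centre, so a point at distance t from it ends at distance |t -
    -- D|. The two bounds on D handle the two signs of t - D.
    away : ∀ {t D} → ι 7 * (b * u′) ≤ ι 4 * D → ι 25 * D ≤ ι 24 * u′ →
      0ℚ ≤ t → t ≤ (ι 1 + (1 ÷ 2) * b) * u′ → ∣ t - D ∣ ≤ (ι 1 - (5 ÷ 4) * b) * u′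
    away {t} {D} D≥ D≤ 0≤t t≤ = ≤⇒∣∣≤
      (lin (t≤ ⊕ (0≤÷ 1 4 ⊛ D≥))
          (solve 4 (λ b v t D → (# 1 :- con (5 ÷ 4) :* b) :* v :- (t :- D)
            := (# 1 :+ con (1 ÷ 2) :* b) :* v :+ con (1 ÷ 4) :* (# 4 :* D) :- (t :+ con (1 ÷ 4)
              :* (# 7 :* (b :* v)))) refl b v t D))
      (lin (0≤t ⊕ (0≤÷ 1 25 ⊛ D≤) ⊕ (0≤÷ 5 128 ⊗ 0≤v ⊛ b≤) ⊕ (0≤÷ 3 3200 ⊛ 0≤v))
          (solve 4 (λ b v t D → (# 1 :- con (5 ÷ 4) :* b) :* v :- :- (t :- D)
            := t :+ (con (1 ÷ 25) :* (# 24 :* v) :+ (con (5 ÷ 128) :* v :* # 1 :+ con (3 ÷ 3200)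
              :* v)) :- (# 0 :+ (con (1 ÷ 25) :* (# 25 :* D) :+ (con (5 ÷ 128) :* v :* (# 32 :*
              b) :+ con (3 ÷ 3200) :* # 0)))) refl b v t D))
    ∣y-z′∣≤ : ∣ y - z′ ∣ ≤ (ι 1 + (1 ÷ 2) * b) * u′
    ∣y-z′∣≤ = subst (_≤ (ι 1 + (1 ÷ 2) * b) * u′) (∣a-b∣≡∣b-a∣ z′ y) near
    direction : ∀ n → 0ℚ ≤ y - z′ ⊎ y - z′ ≤ 0ℚ →
      ι 7 * (b * u′) ≤ ι 4 * offset y n × ι 25 * offset y n ≤ ι 24 * u′ →
      ∃ λ s → Deep b z′ u′ (aside y n s)
    direction n (inj₁ 0≤t) (D≥ , D≤) = false ,
      subst (_≤ (ι 1 - (5 ÷ 4) * b) * u′) (cong ∣_∣ eq) (away D≥ D≤ 0≤t (∣∣≤⇒≤ ∣y-z′∣≤))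
      where
      D = offset y n
      z = z′
      eq : y - z′ - D ≡ y + sgn false * D - z′
      eq = (solve 3 (λ y z D → y :- z :- D := y :+ :- # 1 :* D :- z) refl y z D)
    direction n (inj₂ t≤0) (D≥ , D≤) = true ,
      subst (_≤ (ι 1 - (5 ÷ 4) * b) * u′)
        (trans (sym (ℚ.∣-p∣≡∣p∣ (- (y - z′) - D))) (cong ∣_∣ eq))
        (away D≥ D≤ (lin (t≤0)
            (solve 2 (λ y z → :- (y :- z) :- # 0 := # 0 :- (y :- z)) refl y z)) (∣∣≤⇒-≤ ∣y-z′∣≤))
      where
      D = offset y n
      z = z′
      eq : - (- (y - z′) - D) ≡ y + sgn true * D - z′
      eq = (solve 3 (λ y z D → :- (:- (y :- z) :- D) := y :+ # 1 :* D :- z) refl y z D)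

  -- Good approximations of irrational numbers

  Eventually : (ℕ → Set) → Set
  Eventually P = ∃ λ N → ∀ n → N ℕ.≤ n → P n

  eventually-map : ∀ {P Q} → (∀ {n} → P n → Q n) → Eventually P → Eventually Q
  eventually-map f (N , p) = N , λ n N≤n → f (p n N≤n)

  eventually-zip : ∀ {P Q R} → (∀ {n} → P n → Q n → R n) →
    Eventually P → Eventually Q → Eventually R
  eventually-zip f (M , p) (N , q) = M ℕ.⊔ N , λ n h →
    f (p n (ℕ.m⊔n≤o⇒m≤o M N h)) (q n (ℕ.m⊔n≤o⇒n≤o M N h))

  eventually⇒∃ : ∀ {P} → Eventually P → ∃ P
  eventually⇒∃ (N , p) = N , p N ℕ.≤-refl

  infixl 1 _>>=_

  _>>=_ : ∀ {A B : Set} → ¬ ¬ A → (A → ¬ ¬ B) → ¬ ¬ B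
  (a >>= f) ¬b = a λ x → f x ¬b

  return : ∀ {A : Set} → A → ¬ ¬ A
  return a ¬a = ¬a a

  ∣∣<⇒< : ∀ {a c} → ∣ a ∣ < c → a < c
  ∣∣<⇒< p = ℚ.≤-<-trans (∣∣≤⇒≤ ℚ.≤-refl) p

  ∣∣<⇒-< : ∀ {a c} → ∣ a ∣ < c → - a < c
  ∣∣<⇒-< p = ℚ.≤-<-trans (∣∣≤⇒-≤ ℚ.≤-refl) p

  -- If a term past the Cauchy index for ε/4 were at least ε away from r, all later terms would stay
  -- ε/2 away. If there is no such separation, the terms converge to r.
  irrational⇒apart : ∀ x → Irrational x → ∀ r →
    ¬ ¬ ∃ λ ε → 0ℚ < ε × Eventually (λ n → ε ≤ ∣ seq x n - r ∣)
  irrational⇒apart x irr r ¬apart = irr r (*≃* λ ε 0<ε →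
    let N , close = cauchy x ((1 ÷ 4) * ε) (quarter 0<ε)
    in N , λ n N≤n → ℚ.≰⇒> λ ε≤ → ¬apart
      ((1 ÷ 2) * ε , half 0<ε , N , λ k N≤k →
        far (seq x n) (seq x k) ε 0<ε ε≤ (ℚ.<⇒≤ (close n k N≤n N≤k))))
    where
    quarter : ∀ {ε} → 0ℚ < ε → 0ℚ < (1 ÷ 4) * ε
    quarter = 0<⊗ (ℚ.positive⁻¹ (1 ÷ 4))
    half : ∀ {ε} → 0ℚ < ε → 0ℚ < (1 ÷ 2) * ε
    half = 0<⊗ (ℚ.positive⁻¹ (1 ÷ 2))
    far : ∀ a c ε → 0ℚ < ε → ε ≤ ∣ a - r ∣ → ∣ a - c ∣ ≤ (1 ÷ 4) * ε → (1 ÷ 2) * ε ≤ ∣ c - r ∣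
    far a c ε 0<ε h h′ = let d₁ = ∣ a - r ∣; d₂ = ∣ a - c ∣; d₃ = ∣ c - r ∣ in
      (lin (h ⊕ h′ ⊕ triangle a c r ⊕ (0≤÷ 1 4 ⊛ ℚ.<⇒≤ 0<ε))
          (solve 4 (λ ε d₁ d₂ d₃ → d₃ :- con (1 ÷ 2) :* ε
            := d₁ :+ (con (1 ÷ 4) :* ε :+ (d₂ :+ d₃ :+ con (1 ÷ 4) :* ε)) :- (ε :+ (d₂ :+ (d₁ :+
              con (1 ÷ 4) :* # 0)))) refl ε d₁ d₂ d₃))

  sgn-not : ∀ s → - sgn s ≡ sgn (not s)
  sgn-not true  = refl
  sgn-not false = refl

  OnSide : Bool → ℝ → ℚ → Set
  OnSide s x r = Eventually λ n → 0ℚ ≤ sgn s * (seq x n - r)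

  -- Terms at distance at least ε from r that differ by less than ε from a fixed one of them cannot
  -- change sides.
  comparable : ∀ x → Irrational x → ∀ s r → ¬ ¬ (OnSide s x r ⊎ OnSide (not s) x r)
  comparable x irr s r = irrational⇒apart x irr r >>= λ (ε , 0<ε , M , far) →
    let N , close = cauchy x ε 0<ε
        K = M ℕ.⊔ N
        M≤K = ℕ.m≤m⊔n M N
        N≤K = ℕ.m≤n⊔m M N
        δ = sgn s * (seq x K - r)
        ε≤∣δ∣ : ε ≤ ∣ δ ∣
        ε≤∣δ∣ = subst (ε ≤_) (sym (∣sgn*∣ s (seq x K - r))) (far K M≤K)
        steady : ∀ n → K ℕ.≤ n → ∣ sgn s * (seq x K - seq x n) ∣ < ε
        steady n K≤n = subst (_< ε) (sym (∣sgn*∣ s (seq x K - seq x n)))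
            (close K n N≤K (ℕ.≤-trans N≤K K≤n))
    in return (decide s (seq x K) ε (λ n → steady n) ε≤∣δ∣)
    where
    decide : ∀ s a ε {K} → (∀ n → K ℕ.≤ n → ∣ sgn s * (a - seq x n) ∣ < ε) →
        ε ≤ ∣ sgn s * (a - r) ∣ →
      OnSide s x r ⊎ OnSide (not s) x r
    decide s a ε {K} steady ε≤ with ℚ.∣p∣≡p∨∣p∣≡-p (sgn s * (a - r))
    ... | inj₁ eq = inj₁ (K , λ n K≤n → pos (sgn s) (seq x n) (∣∣<⇒< (steady n K≤n))
        (subst (ε ≤_) eq ε≤))
      where
      pos : ∀ g c → g * (a - c) < ε → ε ≤ g * (a - r) → 0ℚ ≤ g * (c - r)
      pos g c h h′ = lin (ℚ.<⇒≤ h ⊕ h′)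
          (solve 5 (λ g a c r ε → g :* (c :- r) :- # 0
            := ε :+ g :* (a :- r) :- (g :* (a :- c) :+ ε)) refl g a c r ε)
    ... | inj₂ eq = inj₂ (K , λ n K≤n → subst (λ t → 0ℚ ≤ t * (seq x n - r)) (sgn-not s)
        (neg (sgn s) (seq x n) (∣∣<⇒-< (steady n K≤n)) (subst (ε ≤_) eq ε≤)))
      where
      neg : ∀ g c → - (g * (a - c)) < ε → ε ≤ - (g * (a - r)) → 0ℚ ≤ (- g) * (c - r)
      neg g c h h′ = lin (ℚ.<⇒≤ h ⊕ h′)
          (solve 5 (λ g a c r ε → :- g :* (c :- r) :- # 0
            := ε :+ :- (g :* (a :- r)) :- (:- (g :* (a :- c)) :+ ε)) refl g a c r ε)

  Cross : Bool → ℚ → ℚ → Set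
  Cross s y w = ↥ w ℤ.* + ↧ₙ y ℤ.- ↥ y ℤ.* + ↧ₙ w ≡ unit s

  cross-ℚ : ∀ {s} y w → Cross s y w → (w - y) * (den y * den w) ≡ sgn s
  cross-ℚ y w c = trans (cross-multiply {w} {y} {den y} {den w} (*-↧ w) (*-↧ y))
      (cross-fromℤ (↥ w) (+ ↧ₙ y) (↥ y) (+ ↧ₙ w) c)

  cross-swap : ∀ {s} y w → Cross s y w → Cross (not s) w y
  cross-swap {s} y w c = trans (flip (↥ w) (+ ↧ₙ y) (↥ y) (+ ↧ₙ w))
      (trans (cong ℤ.-_ c) (unit-not s))
    where
    flip : ∀ a b c d → c ℤ.* d ℤ.- a ℤ.* b ≡ ℤ.- (a ℤ.* b ℤ.- c ℤ.* d)
    flip = solve-∀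
    unit-not : ∀ s → ℤ.- unit s ≡ unit (not s)
    unit-not true  = refl
    unit-not false = refl

  mediant : ∀ {s} y w → Cross s y w → ∃ λ μ →
    ↧ₙ μ ≡ ↧ₙ y ℕ.+ ↧ₙ w × Cross s y μ × Cross s μ w
  mediant {s} y@(mkℚ a b-1 _) w@(mkℚ c d-1 _) cross =
    mkℚ (a ℤ.+ c) (b-1 ℕ.+ suc d-1)
      (cross-difference⇒coprime a (suc b-1) (a ℤ.+ c) (suc b-1 ℕ.+ suc d-1) (∣unit∣ s) lower)
    , refl , lower , trans (upper-id a (+ suc b-1) c (+ suc d-1)) cross
    where
    lower-id : ∀ a b c d → (a ℤ.+ c) ℤ.* b ℤ.- a ℤ.* (b ℤ.+ d) ≡ c ℤ.* b ℤ.- a ℤ.* d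
    lower-id = solve-∀
    upper-id : ∀ a b c d → c ℤ.* (b ℤ.+ d) ℤ.- (a ℤ.+ c) ℤ.* d ≡ c ℤ.* b ℤ.- a ℤ.* d
    upper-id = solve-∀
    lower : (a ℤ.+ c) ℤ.* + suc b-1 ℤ.- a ℤ.* + (suc b-1 ℕ.+ suc d-1) ≡ unit s
    lower = trans (lower-id a (+ suc b-1) c (+ suc d-1)) cross

  -- Farey neighbours around x. The left one is y if s is `true` and w if s is `false`, so that one
  -- refinement lemma serves both ends.
  record Bracket (x : ℝ) (s : Bool) (y w : ℚ) : Set where
    constructor bracket
    field
      cross : Cross s y w
      left  : OnSide s x y
      right : OnSide (not s) x w

  bracket-swap : ∀ {x s y w} → Bracket x s y w → Bracket x (not s) w y
  bracket-swap {x} {s} {y} {w} (bracket c l r) =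
    bracket (cross-swap y w c) r (subst (λ t → OnSide t x y) (sym (not-involutive s)) l)

  1≤↧ : ∀ y → 1 ℕ.≤ ↧ₙ y
  1≤↧ (mkℚ _ _ _) = ℕ.s≤s ℕ.z≤n

  ∣∣-within : ∀ s {a y w} → 0ℚ ≤ sgn s * (a - y) → 0ℚ ≤ sgn (not s) * (a - w) →
      ∣ a - y ∣ ≤ sgn s * (w - y)
  ∣∣-within s {a} {y} {w} l r = begin
    ∣ a - y ∣            ≡⟨ ∣sgn*∣ s (a - y) ⟨
    ∣ sgn s * (a - y) ∣  ≡⟨ ℚ.0≤p⇒∣p∣≡p l ⟩
    sgn s * (a - y)      ≤⟨ step (sgn s) (subst (λ t → 0ℚ ≤ t * (a - w)) (sym (sgn-not s)) r) ⟩
    sgn s * (w - y)      ∎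
    where
    open ℚ.≤-Reasoning
    step : ∀ g → 0ℚ ≤ (- g) * (a - w) → g * (a - y) ≤ g * (w - y)
    step g h = lin (h)
        (solve 4 (λ g a y w → g :* (w :- y) :- g :* (a :- y)
          := :- g :* (a :- w) :- # 0) refl g a y w)

  width : ∀ s y w → Cross s y w → sgn s * (w - y) * (den y * den w) ≡ 1ℚ
  width s y w c = trans (ℚ.*-assoc (sgn s) (w - y) (den y * den w))
    (trans (cong (sgn s *_) (cross-ℚ y w c)) (sgn² s))

  -- W is the width 1/(q q′) of a bracket; ε ≤ W would force q′ ≤ 1/ε ≤ K.
  narrow : ∀ {K q q′ ε W} → 0ℚ < ε → 0ℚ ≤ q′ → 1ℚ ≤ q → W * (q * q′) ≡ 1ℚ →
    1ℚ ≤ K * ε → 1ℚ + K ≤ q′ → ¬ (ε ≤ W)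
  narrow {K} {q} {q′} {ε} {W} 0<ε 0≤q′ 1≤q Wqq′ 1≤Kε K<q′ ε≤W = <⇒≱ 0<ε
    (lin (1≤Kε ⊕ (ℚ.<⇒≤ 0<ε ⊛ K<q′) ⊕ (0≤q′ ⊛ ε≤W) ⊕ (0≤W ⊗ 0≤q′ ⊛ 1≤q) ⊕ ℚ.≤-reflexive Wqq′)
        (solve 5 (λ K q q′ ε W → # 0 :- ε
          := K :* ε :+ (ε :* q′ :+ (q′ :* W :+ (W :* q′ :* q :+ # 1))) :- (# 1 :+ (ε :* (# 1 :+
            K) :+ (q′ :* ε :+ (W :* q′ :* # 1 :+ W :* (q :* q′)))))) refl K q q′ ε W))
    where
    0≤W = ℚ.≤-trans (ℚ.<⇒≤ 0<ε) ε≤W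

  -- Taking mediants on the side of w for ever would squeeze x onto y, so after
  -- finitely many steps a mediant falls between y and x.
  refine-left : ∀ {x} → Irrational x → ∀ {s y w} → Bracket x s y w → ¬ ¬ ∃₂ λ y′ w′ →
    Bracket x s y′ w′ × ↧ₙ y ℕ.< ↧ₙ y′ × ↧ₙ w ℕ.≤ ↧ₙ w′
  refine-left {x} irr {s} {y} {w} B = irrational⇒apart x irr y >>= λ (ε , 0<ε , far) →
    let K , 1≤Kε = archimedean 1ℚ ε 0<ε in
    steps K >>= λ
      { (inj₁ done) → return done
      ; (inj₂ (w′ , bracket c l r , K<w′ , _)) _ →
          let n , e , l , r = eventually⇒∃ (eventually-zip _,_ far (eventually-zip _,_ l r))
          in narrow 0<ε (0≤ι (↧ₙ w′)) (1≤ι↧ y) (width s y w′ c) 1≤Kε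
               (subst (_≤ den w′) (ι-+ 1 K) (ι-mono-≤ K<w′))
               (ℚ.≤-trans e (∣∣-within s {seq x n} {y} {w′} l r)) }
    where
    Done = ∃₂ λ y′ w′ → Bracket x s y′ w′ × ↧ₙ y ℕ.< ↧ₙ y′ × ↧ₙ w ℕ.≤ ↧ₙ w′
    steps : ∀ k → ¬ ¬ (Done ⊎ ∃ λ w′ → Bracket x s y w′ × k ℕ.< ↧ₙ w′ × ↧ₙ w ℕ.≤ ↧ₙ w′)
    steps zero    = return (inj₂ (w , B , 1≤↧ w , ℕ.≤-refl))
    steps (suc k) = steps k >>= λ
      { (inj₁ done) → return (inj₁ done)
      ; (inj₂ (w′ , bracket c l r , k<w′ , w≤w′)) →
          let μ , den-μ , c₁ , c₂ = mediant {s} y w′ c in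
          comparable x irr s μ >>= λ
            { (inj₁ left) → return (inj₁ (μ , w′ , bracket c₂ left r
                , subst (↧ₙ y ℕ.<_) (sym den-μ)
                    (ℕ.≤-trans (ℕ.≤-reflexive (ℕ.+-comm 1 (↧ₙ y))) (ℕ.+-monoʳ-≤ (↧ₙ y) (1≤↧ w′)))
                , w≤w′))
            ; (inj₂ right) → return (inj₂ (μ , bracket c₁ l right
                , subst (suc k ℕ.<_) (sym den-μ) (ℕ.+-mono-≤ (1≤↧ y) k<w′)
                , subst (↧ₙ w ℕ.≤_) (sym den-μ) (ℕ.≤-trans w≤w′ (ℕ.m≤n+m (↧ₙ w′) (↧ₙ y))))) } }

  initial-bracket : ∀ x → Irrational x → ¬ ¬ ∃₂ λ y w → Bracket x true y w
  initial-bracket x irr =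
    let N , close = cauchy x 1ℚ (ℚ.positive⁻¹ 1ℚ)
        a = seq x N
        K , K≥ = ceiling (a + 1ℚ)
        L , L≥ = ceiling (1ℚ - a)
        lower : OnSide true x (fromℤ (ℤ.- + L))
        lower = N , λ n N≤n → below a (seq x n) (ι L) L≥ (∣∣≤⇒≤ (ℚ.<⇒≤ (close N n ℕ.≤-refl N≤n)))
            (fromℤ-neg (+ L))
        upper : OnSide false x (fromℤ (ℤ.- + L ℤ.+ + (L ℕ.+ K)))
        upper = N , λ n N≤n → above a (seq x n) (ι K) K≥ (∣∣≤⇒-≤ (ℚ.<⇒≤ (close N n ℕ.≤-refl N≤n)))
          (cong fromℤ (cancel (+ L) (+ K)))
    in scan (ℤ.- + L) lower (L ℕ.+ K) upper
    where
    cancel : ∀ a b → ℤ.- a ℤ.+ (a ℤ.+ b) ≡ b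
    cancel = solve-∀
    below : ∀ a c l {m} → 1ℚ - a ≤ l → a - c ≤ 1ℚ → m ≡ - l → 0ℚ ≤ 1ℚ * (c - m)
    below a c l h h′ refl = lin (h ⊕ h′)
        (solve 3 (λ a c l → # 1 :* (c :- :- l) :- # 0
          := l :+ # 1 :- (# 1 :- a :+ (a :- c))) refl a c l)
    above : ∀ a c k {m} → a + 1ℚ ≤ k → - (a - c) ≤ 1ℚ → m ≡ k → 0ℚ ≤ sgn false * (c - m)
    above a c k h h′ refl = lin (h ⊕ h′)
        (solve 3 (λ a c k → :- # 1 :* (c :- k) :- # 0
          := k :+ # 1 :- (a :+ # 1 :+ :- (a :- c))) refl a c k)
    consecutive : ∀ i → Cross true (fromℤ i) (fromℤ (i ℤ.+ + 1))
    consecutive i = step i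
      where
      step : ∀ i → (i ℤ.+ + 1) ℤ.* + 1 ℤ.- i ℤ.* + 1 ≡ + 1
      step = solve-∀
    scan : ∀ i → OnSide true x (fromℤ i) → ∀ k → OnSide false x (fromℤ (i ℤ.+ + k)) →
      ¬ ¬ ∃₂ λ y w → Bracket x true y w
    -- Both bounds are i. Instead of refuting x = i, the upper one is weakened to i + 1.
    scan i l zero    r = return (fromℤ i , fromℤ (i ℤ.+ + 1) , bracket (consecutive i) l
      (eventually-map (λ {n} → weaken (seq x n)) r))
      where
      weaken : ∀ a → 0ℚ ≤ sgn false * (a - fromℤ (i ℤ.+ + 0)) →
          0ℚ ≤ sgn false * (a - fromℤ (i ℤ.+ + 1))
      weaken a h = go (fromℤ-mono-≤ (ℤ.+-monoʳ-≤ i (ℤ.+≤+ (ℕ.z≤n {1})))) h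
        where
        go : ∀ {c d} → c ≤ d → 0ℚ ≤ sgn false * (a - c) → 0ℚ ≤ sgn false * (a - d)
        go {c} {d} c≤d h = lin (h ⊕ c≤d)
            (solve 3 (λ a c d → :- # 1 :* (a :- d) :- # 0
              := :- # 1 :* (a :- c) :+ d :- (# 0 :+ c)) refl a c d)
    scan i l (suc k) r = comparable x irr true (fromℤ (i ℤ.+ + k)) >>= λ
      { (inj₁ left) → return (fromℤ (i ℤ.+ + k) , fromℤ (i ℤ.+ + k ℤ.+ + 1) , bracket
          (consecutive (i ℤ.+ + k)) left
          (subst (λ j → OnSide false x (fromℤ j)) (assoc i (+ k)) r))
      ; (inj₂ right) → scan i l k right }
      where
      assoc : ∀ i k → i ℤ.+ (+ 1 ℤ.+ k) ≡ i ℤ.+ k ℤ.+ + 1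
      assoc = solve-∀

  fine-bracket : ∀ x → Irrational x → ∀ Q → ¬ ¬ ∃₂ λ y w →
    Bracket x true y w × Q ℕ.< ↧ₙ y × Q ℕ.< ↧ₙ w
  fine-bracket x irr zero = initial-bracket x irr >>= λ (y , w , B) →
    return (y , w , B , 1≤↧ y , 1≤↧ w)
  fine-bracket x irr (suc Q) = fine-bracket x irr Q >>= λ (y , w , B , Q<y , Q<w) →
    refine-left irr B >>= λ (y′ , w′ , B′ , y<y′ , w≤w′) →
    refine-left irr (bracket-swap B′) >>= λ (w″ , y″ , B″ , w′<w″ , y′≤y″) →
    return (y″ , w″ , bracket-swap B″
      , ℕ.≤-trans (ℕ.s≤s Q<y) (ℕ.≤-trans y<y′ y′≤y″)
      , ℕ.≤-trans (ℕ.s≤s (ℕ.≤-trans Q<w w≤w′)) w′<w″)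

  Approximates : ℝ → ℚ → Set
  Approximates x y = Eventually λ n → ι 2 * ∣ seq x n - y ∣ * (den y * den y) ≤ 1ℚ

  -- Vahlen's argument: (q - q′)² ≥ 0 gives 1/(q q′) ≤ 1/(2q²) + 1/(2q′²), so the intervals of these
  -- radii about y and w cover the bracket. Comparing x with y + 1/(2q²) tells which one to take.
  good-approximations : ∀ x → Irrational x → ∀ Q → ¬ ¬ ∃ λ y → Q ℕ.≤ ↧ₙ y × Approximates x y
  good-approximations x irr Q = fine-bracket x irr Q >>= λ (y , w , bracket c l r , Q<y , Q<w) →
    let q = den y
        q′ = den w
        h , 0<h , hq²≡1 = reciprocal (ι 2 * (q * q)) (0<⊗ (0<ι 2) (0<⊗ (0<ι↧ y) (0<ι↧ y)))
    in comparable x irr false (y + h) >>= λ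
      { (inj₁ x≤y+h) → return (y , ℕ.<⇒≤ Q<y , eventually-zip
          (λ {n} → near-left (seq x n) y h (0≤ι (↧ₙ y)) hq²≡1) l x≤y+h)
      ; (inj₂ x≥y+h) → return (w , ℕ.<⇒≤ Q<w , eventually-zip
          (λ {n} → near-right (seq x n) y w h (0<ι↧ y) (0≤ι (↧ₙ w)) hq²≡1 (width true y w c))
              x≥y+h r) }
    where
    near-left : ∀ a y h {q} → 0ℚ ≤ q → h * (ι 2 * (q * q)) ≡ 1ℚ → 0ℚ ≤ sgn true * (a - y) →
      0ℚ ≤ sgn false * (a - (y + h)) → ι 2 * ∣ a - y ∣ * (q * q) ≤ 1ℚ
    near-left a y h {q} 0≤q hq²≡1 l u = let d = ∣ a - y ∣ in
      (lin ((0≤ι 2 ⊗ 0≤q ⊗ 0≤q ⊛ d≤h) ⊕ ℚ.≤-reflexive hq²≡1)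
          (solve 3 (λ d h q → # 1 :- # 2 :* d :* (q :* q)
            := # 2 :* (q :* q) :* h :+ # 1 :- (# 2 :* (q :* q) :* d :+ h :* (# 2 :* (q :*
              q)))) refl d h q))
      where
      d≤h : ∣ a - y ∣ ≤ h
      d≤h = ℚ.≤-trans (∣∣-within true {a} {y} {y + h} l u) (ℚ.≤-reflexive (solve 2 (λ y h → # 1
            :* (y :+ h :- y)
            := h) refl y h))
    near-right : ∀ a y w h {q q′} → 0ℚ < q → 0ℚ ≤ q′ → h * (ι 2 * (q * q)) ≡ 1ℚ →
      sgn true * (w - y) * (q * q′) ≡ 1ℚ → 0ℚ ≤ sgn true * (a - (y + h)) →
          0ℚ ≤ sgn false * (a - w) →
      ι 2 * ∣ a - w ∣ * (q′ * q′) ≤ 1ℚ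
    near-right a y w h {q} {q′} 0<q 0≤q′ hq²≡1 W u r = *-cancel-≤ (0<⊗ 0<q 0<q)
      (let d = ∣ a - w ∣ in
      (lin (((0≤ι 2 ⊗ 0≤q ⊗ 0≤q) ⊗ 0≤q′ ⊗ 0≤q′ ⊛ d≤) ⊕ (0≤q′ ⊗ 0≤q′ ⊛ ℚ.≤-reflexive (sym hq²≡1))
            ⊕ (0≤ι 2 ⊗ 0≤q ⊗ 0≤q′ ⊛ ℚ.≤-reflexive W) ⊕ 0≤square (q - q′))
          (solve 6 (λ d y w h q q′ → q :* q :* # 1 :- q :* q :* (# 2 :* d :* (q′ :* q′))
            := # 2 :* (q :* q) :* (q′ :* q′) :* (w :- y :- h) :+ (q′ :* q′ :* (h :* (# 2 :* (q
              :* q))) :+ (# 2 :* (q :* q′) :* # 1 :+ (q :- q′) :* (q :- q′))) :- (# 2 :* (q :*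
              q) :* (q′ :* q′) :* d :+ (q′ :* q′ :* # 1 :+ (# 2 :* (q :* q′) :* (# 1 :* (w :- y)
              :* (q :* q′)) :+ # 0)))) refl d y w h q q′)))
      where
      0≤q = ℚ.<⇒≤ 0<q
      d≤ : ∣ a - w ∣ ≤ w - y - h
      d≤ = ℚ.≤-trans (∣∣-within false {a} {w} {y + h} r u) (ℚ.≤-reflexive (solve 3 (λ y w h → :-
            # 1 :* (y :+ h :- w)
            := w :- y :- h) refl y w h))

  -- Approximate data of a ball and bounded search

  record Approximation (η : ℚ) (s : ℕ → ℚ) : Set where
    constructor approximation
    field
      value  : ℚ
      0<value : 0ℚ < value
      lower  : Eventually λ n → value ≤ s n
      upper  : Eventually λ n → s n ≤ (ι 1 + η) * value

  -- A late term, lowered by ε, bounds the later ones from below. As ε is proportional to η g and g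
  -- bounds the terms from below, the total error is at most η times the value.
  approximate : ∀ {s g} η → 0ℚ < η → η ≤ ι 1 → IsCauchy s → 0ℚ < g → Eventually (λ n → g ≤ s n) →
      Approximation η s
  approximate {s} {g} η 0<η η≤1 c 0<g (M , g≤) =
    let N , close = c ε 0<ε
        K = M ℕ.⊔ N
        K≥N = ℕ.m≤n⊔m M N
        g≤a = g≤ K (ℕ.m≤m⊔n M N)
    in approximation (s K - ε) (value>0 (s K) g≤a)
        (K , λ n K≤n → below (s K) (s n) (∣∣≤⇒≤ (ℚ.<⇒≤ (close K n K≥N (ℕ.≤-trans K≥N K≤n)))))
        (K , λ n K≤n → above (s K) (s n) g≤a (∣∣≤⇒-≤ (ℚ.<⇒≤ (close K n K≥N (ℕ.≤-trans K≥N K≤n)))))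
    where
    ε = (1 ÷ 4) * (η * g)
    0<ηg = 0<⊗ 0<η 0<g
    0<ε : 0ℚ < ε
    0<ε = 0<⊗ (ℚ.positive⁻¹ (1 ÷ 4)) 0<ηg
    0≤g = ℚ.<⇒≤ 0<g
    value>0 : ∀ a → g ≤ a → 0ℚ < a - ε
    value>0 a g≤a = lin< ((ℚ.positive⁻¹ (3 ÷ 4) ⊛< 0<g) <⊕ g≤a ⊕ (0≤÷ 1 4 ⊗ 0≤g ⊛ η≤1))
        (solve 3 (λ a g η → a :- con (1 ÷ 4) :* (η :* g) :- # 0
          := con (3 ÷ 4) :* g :+ (a :+ con (1 ÷ 4) :* g :* # 1) :- (con (3 ÷ 4) :* # 0 :+ (g :+
            con (1 ÷ 4) :* g :* η))) refl a g η)
    below : ∀ a e → a - e ≤ ε → a - ε ≤ e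
    below a e h = lin (h)
        (solve 4 (λ a e η g → e :- (a :- con (1 ÷ 4) :* (η :* g))
          := con (1 ÷ 4) :* (η :* g) :- (a :- e)) refl a e η g)
    above : ∀ a e → g ≤ a → - (a - e) ≤ ε → e ≤ (ι 1 + η) * (a - ε)
    above a e g≤a h = lin (h ⊕ (ℚ.<⇒≤ 0<η ⊛ g≤a) ⊕ (0≤÷ 1 4 ⊗ ℚ.<⇒≤ 0<ηg ⊛ η≤1) ⊕ (0≤÷ 1 4 ⊗
          ℚ.<⇒≤ 0<ηg ⊛ 0≤ι 1))
        (solve 4 (λ a e η g → (# 1 :+ η) :* (a :- con (1 ÷ 4) :* (η :* g)) :- e
          := con (1 ÷ 4) :* (η :* g) :+ (η :* a :+ (con (1 ÷ 4) :* (η :* g) :* # 1 :+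
            con (1 ÷ 4) :* (η :* g) :* # 1)) :- (:- (a :- e) :+ (η :* g :+ (con (1 ÷ 4) :* (η :*
            g) :* η :+ con (1 ÷ 4) :* (η :* g) :* # 0)))) refl a e η g)

  ∣fromℤ∣ : ∀ i → ι ℤ.∣ i ∣ ≡ ∣ fromℤ i ∣
  ∣fromℤ∣ (+ n)    = refl
  ∣fromℤ∣ -[1+ n ] = refl

  -- A bound on the denominator and on |y| also bounds the numerator. The candidates n/d need not be
  -- reduced; it is enough that every y occurs with its own numerator and denominator.
  ∃ℚ? : ∀ {P : ℚ → Set} → (∀ y → Dec (P y)) → ∀ C M →
    (∀ y → P y → den y ≤ C × ∣ y ∣ ≤ M) → Dec (∃ P)
  ∃ℚ? {P} P? C M bound = map′ found lost
    (ℕ.anyUpTo? (λ d → ℕ.anyUpTo? (λ n → P? (+ n / suc d) ⊎-dec P? (ℤ.- + n / suc d)) K) K)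
    where
    K₁ = proj₁ (ceiling C)
    K₂ = proj₁ (ceiling (∣ M ∣ * ι K₁))
    K = suc (K₁ ℕ.+ K₂)
    found : (∃ λ d → d ℕ.< K × ∃ λ n → n ℕ.< K × (P (+ n / suc d) ⊎ P (ℤ.- + n / suc d))) → ∃ P
    found (d , _ , n , _ , inj₁ p) = _ , p
    found (d , _ , n , _ , inj₂ p) = _ , p
    lost : ∃ P → ∃ λ d → d ℕ.< K × ∃ λ n → n ℕ.< K × (P (+ n / suc d) ⊎ P (ℤ.- + n / suc d))
    lost (y@(mkℚ i d-1 _) , p) =
        d-1 , ℕ.s≤s (ℕ.≤-trans (ℕ.≤-trans (ℕ.n≤1+n d-1) d≤) (ℕ.m≤m+n K₁ K₂))
      , ℤ.∣ i ∣ , ℕ.s≤s (ℕ.≤-trans i≤ (ℕ.m≤n+m K₂ K₁)) , member i (subst P (sym (ℚ.↥p/↧p≡p y)) p)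
      where
      d≤ : suc d-1 ℕ.≤ K₁
      d≤ = ι-cancel-≤ (ℚ.≤-trans (proj₁ (bound y p)) (proj₂ (ceiling C)))
      i≤ : ℤ.∣ i ∣ ℕ.≤ K₂
      i≤ = ι-cancel-≤ (begin
        ι ℤ.∣ i ∣           ≡⟨ ∣fromℤ∣ i ⟩
        ∣ fromℤ i ∣         ≡⟨ cong ∣_∣ (*-↧ y) ⟨
        ∣ y * den y ∣       ≡⟨ ℚ.∣p*q∣≡∣p∣*∣q∣ y (den y) ⟩
        ∣ y ∣ * den y       ≤⟨ ℚ.0≤∣p∣ y ⊛ ι-mono-≤ d≤ ⟩
        ∣ y ∣ * ι K₁        ≤⟨ ℚ.*-monoʳ-≤-nonNeg (ι K₁)
            (ℚ.≤-trans (proj₂ (bound y p)) (∣∣≤⇒≤ ℚ.≤-refl)) ⟩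
        ∣ M ∣ * ι K₁        ≤⟨ proj₂ (ceiling (∣ M ∣ * ι K₁)) ⟩
        ι K₂                ∎)
        where open ℚ.≤-Reasoning
      member : ∀ i → P (i / suc d-1) → P (+ ℤ.∣ i ∣ / suc d-1) ⊎ P (ℤ.- + ℤ.∣ i ∣ / suc d-1)
      member (+ n)    p = inj₁ p
      member -[1+ n ] p = inj₂ p

  ∣y∣≤ : ∀ {y z e} → ∣ y - z ∣ ≤ e → ∣ y ∣ ≤ e + ∣ z ∣
  ∣y∣≤ {y} {z} {e} h = begin
    ∣ y ∣                ≡⟨ cong ∣_∣ (solve 2 (λ y z → y :- z :+ z := y) refl y z) ⟨
    ∣ (y - z) + z ∣      ≤⟨ ℚ.∣p+q∣≤∣p∣+∣q∣ (y - z) z ⟩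
    ∣ y - z ∣ + ∣ z ∣    ≤⟨ ℚ.+-monoˡ-≤ ∣ z ∣ h ⟩
    e + ∣ z ∣            ∎
    where open ℚ.≤-Reasoning

  deep-radius≤ : ∀ {b u} → 0ℚ ≤ b → 0ℚ ≤ u → (ι 1 - (5 ÷ 4) * b) * u ≤ u
  deep-radius≤ {b} {u} 0≤b 0≤u = lin ((0≤÷ 5 4 ⊗ 0≤b ⊛ 0≤u))
      (solve 2 (λ b u → u :- (# 1 :- con (5 ÷ 4) :* b) :* u
        := con (5 ÷ 4) :* b :* u :- con (5 ÷ 4) :* b :* # 0) refl b u)

  square-bound : ∀ y {C k} → 0ℚ < k → C * k ≡ 1ℚ → k * (den y * den y) ≤ ι 1 → den y ≤ C
  square-bound y {C} {k} 0<k Ck≡1 h = *-cancel-≤ 0<k (go (0≤ι (↧ₙ y)) (1≤ι↧ y) h)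
    where
    go : ∀ {q} → 0ℚ ≤ q → 1ℚ ≤ q → k * (q * q) ≤ ι 1 → k * q ≤ k * C
    go {q} 0≤q 1≤q h = lin ((ℚ.<⇒≤ 0<k ⊗ 0≤q ⊛ 1≤q) ⊕ h ⊕ ℚ.≤-reflexive (sym Ck≡1))
        (solve 3 (λ k q C → k :* C :- k :* q
          := k :* q :* q :+ (# 1 :+ C :* k) :- (k :* q :* # 1 :+ (k :* (q :* q) :+
            # 1))) refl k q C)

  ∃Target? : ∀ {U b z u} → 0ℚ < U → 0ℚ < b → 0ℚ < u → Dec (∃ (Target U b z u))
  ∃Target? {U} {b} {z} {u} 0<U 0<b 0<u =
    let C , _ , Ck≡1 = reciprocal (U * u) (0<⊗ 0<U 0<u)
    in ∃ℚ? Target? C (u + ∣ z ∣) λ y (target deep _ small) →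
      square-bound y (0<⊗ 0<U 0<u) Ck≡1
          (subst (_≤ ι 1) (sym (ℚ.*-assoc U u (den y * den y))) small)
      , ∣y∣≤ (ℚ.≤-trans deep (deep-radius≤ (ℚ.<⇒≤ 0<b) (ℚ.<⇒≤ 0<u)))
    where
    Target? : ∀ y → Dec (Target U b z u y)
    Target? y = map′ (λ (d , l , s) → target d l s) (λ (target d l s) → d , l , s)
      ((∣ y - z ∣ ℚ.≤? (ι 1 - (5 ÷ 4) * b) * u)
        ×-dec (ι 2 ℚ.≤? ι 3 * (u * (den y * den y)))
        ×-dec (U * (u * (den y * den y)) ℚ.≤? ι 1))

  ∃Bool? : ∀ {P : Bool → Set} → (∀ s → Dec (P s)) → Dec (∃ P)
  ∃Bool? P? = map′ [ (λ p → true , p) , (λ p → false , p) ]′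
    (λ { (true , p) → inj₁ p ; (false , p) → inj₂ p }) (P? true ⊎-dec P? false)

  offset≤1 : ∀ y n → offset y n ≤ 1ℚ
  offset≤1 y n = go (0≤offset y n) (1≤ι↧ y) (1≤ι (suc n)) (offset-* y n)
    where
    go : ∀ {D q m} → 0ℚ ≤ D → 1ℚ ≤ q → 1ℚ ≤ m → D * (q * m) ≡ 1ℚ → D ≤ 1ℚ
    go {D} {q} {m} 0≤D 1≤q 1≤m e = lin (ℚ.≤-reflexive e ⊕ (0≤D ⊗ ℚ.≤-trans (0≤ι 1) 1≤q ⊛ 1≤m) ⊕
          (0≤D ⊛ 1≤q))
        (solve 3 (λ D q m → # 1 :- D
          := # 1 :+ (D :* q :* m :+ D :* q) :- (D :* (q :* m) :+ (D :* q :* # 1 :+ D :*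
            # 1))) refl D q m)

  -- Only the displaced point is known to be near z. Since the offset is at most 1, the bound for
  -- |y| grows by `1ℚ`. The index is bounded by m ≤ m² ≤ 9/(b u).
  ∃Detour? : ∀ {b z u} → 0ℚ < b → 0ℚ < u → Dec (∃ λ y → ∃₂ (Detour b z u y))
  ∃Detour? {b} {z} {u} 0<b 0<u =
    let C , _ , Ck≡1 = reciprocal (b * u) 0<bu
        K , 9C≤K = ceiling (ι 9 * C)
    in ∃ℚ? (inner C K Ck≡1 9C≤K) C (u + ∣ z ∣ + 1ℚ) (bound C Ck≡1)
    where
    0<bu = 0<⊗ 0<b 0<u
    Detour? : ∀ y n s → Dec (Detour b z u y n s)
    Detour? y n s = map′ (λ (d , l , m , r) → detour d l m r) (λ (detour d l m r) → d , l , m , r)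
      ((∣ aside y n s - z ∣ ℚ.≤? (ι 1 - (5 ÷ 4) * b) * u)
        ×-dec (ι 30 * (den y * den y * (b * u)) ℚ.≤? ι 1)
        ×-dec (ι 4 ℚ.≤? ι (suc n) * ι (suc n) * (b * u))
        ×-dec (ι (suc n) * ι (suc n) * (b * u) ℚ.≤? ι 9))
    den-bound : ∀ y → ι 30 * (den y * den y * (b * u)) ≤ ι 1 → b * u * (den y * den y) ≤ ι 1
    den-bound y = go (0≤square (den y))
      where
      go : ∀ {s} → 0ℚ ≤ s → ι 30 * (s * (b * u)) ≤ ι 1 → b * u * s ≤ ι 1
      go {s} 0≤s h = lin (h ⊕ (0≤ι 29 ⊗ 0≤s ⊛ ℚ.<⇒≤ 0<bu))
          (solve 3 (λ s b u → # 1 :- b :* u :* s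
            := # 1 :+ # 29 :* s :* (b :* u) :- (# 30 :* (s :* (b :* u)) :+ # 29 :* s :*
              # 0)) refl s b u)
    n<K : ∀ C K → C * (b * u) ≡ 1ℚ → ι 9 * C ≤ ι K → ∀ y n {s} → Detour b z u y n s → n ℕ.< K
    n<K C K Ck≡1 9C≤K y n p = ι-cancel-≤
        (ℚ.≤-trans (*-cancel-≤ 0<bu (go (1≤ι (suc n)) (Detour.m²≤9 p))) 9C≤K)
      where
      go : ∀ {m} → 1ℚ ≤ m → m * m * (b * u) ≤ ι 9 → b * u * m ≤ b * u * (ι 9 * C)
      go {m} 1≤m h = lin ((ℚ.<⇒≤ 0<bu ⊗ ℚ.≤-trans (0≤ι 1) 1≤m ⊛ 1≤m) ⊕ h ⊕ (0≤ι 9 ⊛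
            ℚ.≤-reflexive (sym Ck≡1)))
          (solve 4 (λ b u m C → b :* u :* (# 9 :* C) :- b :* u :* m
            := b :* u :* m :* m :+ (# 9 :+ # 9 :* (C :* (b :* u))) :- (b :* u :* m :* # 1 :+ (m
              :* m :* (b :* u) :+ # 9 :* # 1))) refl b u m C)
    ∣y∣≤₂ : ∀ y n s {M} → ∣ aside y n s ∣ ≤ M → ∣ y ∣ ≤ M + 1ℚ
    ∣y∣≤₂ y n s {M} h = begin
      ∣ y ∣                                        ≡⟨ cong ∣_∣ (cancel y (sgn s * offset y n)) ⟩
      ∣ aside y n s - sgn s * offset y n ∣         ≤⟨ ℚ.∣p-q∣≤∣p∣+∣q∣ (aside y n s)
          (sgn s * offset y n) ⟩
      ∣ aside y n s ∣ + ∣ sgn s * offset y n ∣     ≤⟨ ℚ.+-mono-≤ h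
          (ℚ.≤-reflexive (∣sgn*∣ s (offset y n))) ⟩
      M + ∣ offset y n ∣                           ≡⟨ cong (λ t → M + t)
          (ℚ.0≤p⇒∣p∣≡p (0≤offset y n)) ⟩
      M + offset y n                               ≤⟨ ℚ.+-monoʳ-≤ M (offset≤1 y n) ⟩
      M + 1ℚ ∎
      where
      open ℚ.≤-Reasoning
      cancel : ∀ y d → y ≡ y + d - d
      cancel y d = (solve 2 (λ y d → y := y :+ d :- d) refl y d)
    inner : ∀ C K → C * (b * u) ≡ 1ℚ → ι 9 * C ≤ ι K → ∀ y → Dec (∃₂ (Detour b z u y))
    inner C K Ck≡1 9C≤K y = map′ (λ (n , _ , p) → n , p) smaller
      (ℕ.anyUpTo? (λ n → ∃Bool? (Detour? y n)) K)
      where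
      smaller : ∃₂ (Detour b z u y) → ∃ λ n → n ℕ.< K × ∃ (Detour b z u y n)
      smaller (n , s , p) = n , n<K C K Ck≡1 9C≤K y n {s} p , s , p
    bound : ∀ C → C * (b * u) ≡ 1ℚ → ∀ y → ∃₂ (Detour b z u y) →
        den y ≤ C × ∣ y ∣ ≤ u + ∣ z ∣ + 1ℚ
    bound C Ck≡1 y (n , s , p) = square-bound y 0<bu Ck≡1 (den-bound y (Detour.q²≤ p))
      , ∣y∣≤₂ y n s (∣y∣≤ (ℚ.≤-trans (Detour.deep p) (deep-radius≤ (ℚ.<⇒≤ 0<b) (ℚ.<⇒≤ 0<u))))

  -- From real balls to their rational data

  product-bounds : ∀ {b u β r} → 0ℚ < b → ι 32 * b ≤ ι 1 → 0ℚ < u →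
    b ≤ β → β ≤ (ι 1 + (1 ÷ 100)) * b → u ≤ r → r ≤ (ι 1 + (1 ÷ 8) * b) * u →
    b * u ≤ β * r × β * r ≤ (51 ÷ 50) * (b * u)
  product-bounds {b} {u} {β} {r} 0<b b≤ 0<u b≤β β≤ u≤r r≤ =
    lin ((0≤β ⊛ u≤r) ⊕ (0≤u ⊛ b≤β))
        (solve 4 (λ b u β r → β :* r :- b :* u
          := β :* r :+ u :* β :- (β :* u :+ u :* b)) refl b u β r) ,
    (lin ((0≤r ⊛ β≤) ⊕ (0≤÷ 101 100 ⊗ 0≤b ⊛ r≤) ⊕ (0≤÷ 101 25600 ⊗ 0≤b ⊗ 0≤u ⊛ b≤) ⊕ (0≤÷ 31 5120
          ⊛ 0≤b ⊗ 0≤u))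
        (solve 4 (λ b u β r → con (51 ÷ 50) :* (b :* u) :- β :* r
          := r :* ((# 1 :+ con (1 ÷ 100)) :* b) :+ (con (101 ÷ 100) :* b :* ((# 1 :+ con (1 ÷ 8)
            :* b) :* u) :+ (con (101 ÷ 25600) :* (b :* u) :* # 1 :+ con (31 ÷ 5120) :* (b :*
            u))) :- (r :* β :+ (con (101 ÷ 100) :* b :* r :+ (con (101 ÷ 25600) :* (b :* u) :*
            (# 32 :* b) :+ con (31 ÷ 5120) :* # 0)))) refl b u β r))
    where
    0≤b = ℚ.<⇒≤ 0<b
    0≤u = ℚ.<⇒≤ 0<u
    0≤β = ℚ.≤-trans 0≤b b≤β
    0≤r = ℚ.≤-trans 0≤u u≤r

  -- A ball of radius r inside one of radius p ≈ 2r about y has its centre within p - r ≈ r of y.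
  -- The errors in units of b v are 1/8 for the centre, 1/8 for the radius, 1/12 for the inclusion
  -- and twice 1/12 for the halving; they add up to the 1/2 in `near`.
  legal-step-bounds : ∀ {b u z y c r p v} → 0ℚ < b → ι 32 * b ≤ ι 1 → 0ℚ < v →
    ∣ c - z ∣ ≤ (1 ÷ 8) * b * v → v ≤ r → r ≤ (ι 1 + (1 ÷ 8) * b) * v →
    b * u ≤ p → p ≤ (51 ÷ 50) * (b * u) →
    ∣ c + r - y ∣ ≤ p + (1 ÷ 12) * (b * v) → ∣ c - r - y ∣ ≤ p + (1 ÷ 12) * (b * v) →
    ∣ r - (1 ÷ 2) * p ∣ ≤ (1 ÷ 12) * (b * v) → Step b u y z v
  legal-step-bounds {b} {u} {z} {y} {c} {r} {p} {v} 0<b b≤ 0<v c~z v≤r r≤ bu≤p p≤ right left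
      half = record
    { 0<u′ = 0<v
    ; near = ≤⇒∣∣≤
        (lin (∣∣≤⇒-≤ c~z ⊕ ∣∣≤⇒≤ right ⊕ (0≤ι 2 ⊛ ∣∣≤⇒-≤ half) ⊕ r≤)
            (solve 7 (λ b z y c r p v → (# 1 :+ con (1 ÷ 2) :* b) :* v :- (z :- y)
              := con (1 ÷ 8) :* b :* v :+ (p :+ con (1 ÷ 12) :* (b :* v) :+ (# 2 :*
                (con (1 ÷ 12) :* (b :* v)) :+ (# 1 :+ con (1 ÷ 8) :* b) :* v)) :- (:- (c :- z)
                :+ (c :+ r :- y :+ (# 2 :* (:- (r :- con (1 ÷ 2) :* p)) :+
                r)))) refl b z y c r p v))
        (lin (∣∣≤⇒≤ c~z ⊕ ∣∣≤⇒-≤ left ⊕ (0≤ι 2 ⊛ ∣∣≤⇒-≤ half) ⊕ r≤)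
            (solve 7 (λ b z y c r p v → (# 1 :+ con (1 ÷ 2) :* b) :* v :- :- (z :- y)
              := con (1 ÷ 8) :* b :* v :+ (p :+ con (1 ÷ 12) :* (b :* v) :+ (# 2 :*
                (con (1 ÷ 12) :* (b :* v)) :+ (# 1 :+ con (1 ÷ 8) :* b) :* v)) :- (c :- z :+ (:-
                (c :- r :- y) :+ (# 2 :* (:- (r :- con (1 ÷ 2) :* p)) :+
                r)))) refl b z y c r p v))
    ; u′≤bu = lin ((0≤÷ 76800 383 ⊛ v≤r) ⊕ (0≤÷ 76800 383 ⊛ ∣∣≤⇒≤ half) ⊕ (0≤÷ 38400 383 ⊛ p≤) ⊕
          (0≤÷ 200 383 ⊗ 0≤v ⊛ b≤) ⊕ (0≤÷ 14050 383 ⊛ bu≤p ) ⊕ (0≤÷ 14050 383 ⊛ p≤))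
        (solve 5 (λ b u r p v → # 103 :* (b :* u) :- # 200 :* v
          := con (76800 ÷ 383) :* r :+ (con (76800 ÷ 383) :* (con (1 ÷ 12) :* (b :* v)) :+
            (con (38400 ÷ 383) :* (con (51 ÷ 50) :* (b :* u)) :+ (con (200 ÷ 383) :* v :* # 1 :+
            (con (14050 ÷ 383) :* p :+ con (14050 ÷ 383) :* (con (51 ÷ 50) :* (b :* u)))))) :-
            (con (76800 ÷ 383) :* v :+ (con (76800 ÷ 383) :* (r :- con (1 ÷ 2) :* p) :+
            (con (38400 ÷ 383) :* p :+ (con (200 ÷ 383) :* v :* (# 32 :* b) :+
            (con (14050 ÷ 383) :* (b :* u) :+ con (14050 ÷ 383) :* p)))))) refl b u r p v)
    ; bu≤u′ = lin ((0≤ι 10 ⊛ bu≤p) ⊕ (0≤ι 20 ⊛ ∣∣≤⇒-≤ half) ⊕ (0≤ι 20 ⊛ r≤) ⊕ (0≤÷ 25 192 ⊗ 0≤v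
          ⊛ b≤) ⊕ (0≤÷ 167 192 ⊛ 0≤v))
        (solve 5 (λ b u r p v → # 21 :* v :- # 10 :* (b :* u)
          := # 10 :* p :+ (# 20 :* (con (1 ÷ 12) :* (b :* v)) :+ (# 20 :* ((# 1 :+ con (1 ÷ 8)
            :* b) :* v) :+ (con (25 ÷ 192) :* v :* # 1 :+ con (167 ÷ 192) :* v))) :- (# 10 :* (b
            :* u) :+ (# 20 :* (:- (r :- con (1 ÷ 2) :* p)) :+ (# 20 :* r :+ (con (25 ÷ 192) :* v
            :* (# 32 :* b) :+ con (167 ÷ 192) :* # 0))))) refl b u r p v) }
    where
    0≤v = ℚ.<⇒≤ 0<v

  -- The coefficient 5/4 in `Deep` pays 101/100 for the radius of Bob's ball and 1/8 for the error
  -- of the centre; 23/200 is left.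
  deep⇒legal : ∀ {b u z y c r p a ε} → 0ℚ < b → ι 32 * b ≤ ι 1 → 0ℚ < u → Deep b z u y →
    ∣ c - z ∣ ≤ (1 ÷ 8) * b * u → u ≤ r → p ≤ (ι 1 + (1 ÷ 100)) * b * r →
    ∣ a - y ∣ ≤ p + ε → ∣ a - c ∣ ≤ r + ε
  deep⇒legal {b} {u} {z} {y} {c} {r} {p} {a} {ε} 0<b b≤ 0<u deep c~z u≤r p≤ h = ℚ.≤-trans
    (ℚ.≤-trans (triangle a y c) (ℚ.+-monoʳ-≤ ∣ a - y ∣ (triangle y z c))) (ℚ.≤-trans
      (ℚ.+-mono-≤ h (ℚ.+-mono-≤ deep (subst (_≤ (1 ÷ 8) * b * u) (∣a-b∣≡∣b-a∣ c z) c~z)))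
      (lin (p≤ ⊕ (0≤slack ⊛ u≤r) ⊕ (0≤÷ 23 200 ⊛ 0≤b ⊗ 0≤u))
          (solve 5 (λ b u r p ε → r :+ ε :- (p :+ ε :+ ((# 1 :- con (5 ÷ 4) :* b) :* u :+
            con (1 ÷ 8) :* b :* u))
            := (# 1 :+ con (1 ÷ 100)) :* b :* r :+ ((# 1 :- con (101 ÷ 100) :* b) :* r :+
              con (23 ÷ 200) :* (b :* u)) :- (p :+ ((# 1 :- con (101 ÷ 100) :* b) :* u :+
              con (23 ÷ 200) :* # 0))) refl b u r p ε)))
    where
    0≤b = ℚ.<⇒≤ 0<b
    0≤u = ℚ.<⇒≤ 0<u
    0≤slack : 0ℚ ≤ ι 1 - (101 ÷ 100) * b
    0≤slack = lin ((0≤÷ 101 3200 ⊛ b≤) ⊕ 0≤÷ 3099 3200)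
        (solve 1 (λ b → # 1 :- con (101 ÷ 100) :* b :- # 0
          := con (101 ÷ 3200) :* # 1 :+ con (3099 ÷ 3200) :- (con (101 ÷ 3200) :* (# 32 :* b) :+
            # 0)) refl b)

  -- With h = 1/q², the bound on u q² gives u ≤ 17h, so x is within about 17βh of the fraction. The
  -- gap between 17 and 18 exceeds all the errors.
  too-close : ∀ {b u β r d h q} → 0ℚ < b → ι 32 * b ≤ ι 1 → 0ℚ < h → 0ℚ ≤ u →
    h * (q * q) ≡ 1ℚ → (1 ÷ 17) * (u * (q * q)) ≤ ι 1 → b ≤ β → r ≤ (ι 1 + (1 ÷ 8) * b) * u →
    d ≤ β * r + (1 ÷ 4) * (b * h) → ¬ (ι 18 * β * h ≤ d + (1 ÷ 4) * (b * h))
  too-close {b} {u} {β} {r} {d} {h} {q} 0<b b≤ 0<h 0≤u hq² small b≤β r≤ d≤ bad = <⇒≱ 0<bh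
    (*-cancel-≤ (ℚ.positive⁻¹ (111 ÷ 256))
    (lin (bad ⊕ d≤ ⊕ (0≤β ⊛ r≤) ⊕ (0≤β ⊗ (0≤ι 1 ⊕ 0≤÷ 1 8 ⊗ 0≤b) ⊛ u≤17h) ⊕ (0≤÷ 17 256 ⊗ 0≤β ⊗
          0≤h ⊛ b≤) ⊕ (0≤÷ 239 256 ⊗ 0≤h ⊛ b≤β))
        (solve 6 (λ b β u r d h → con (111 ÷ 256) :* # 0 :- con (111 ÷ 256) :* (b :* h)
          := d :+ con (1 ÷ 4) :* (b :* h) :+ (β :* r :+ con (1 ÷ 4) :* (b :* h) :+ (β :* ((# 1
            :+ con (1 ÷ 8) :* b) :* u) :+ (β :* (# 1 :+ con (1 ÷ 8) :* b) :* (# 17 :* h) :+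
            (con (17 ÷ 256) :* (β :* h) :* # 1 :+ con (239 ÷ 256) :* h :* β)))) :- (# 18 :* β :*
            h :+ (d :+ (β :* r :+ (β :* (# 1 :+ con (1 ÷ 8) :* b) :* u :+ (con (17 ÷ 256) :* (β
            :* h) :* (# 32 :* b) :+ con (239 ÷ 256) :* h :* b)))))) refl b β u r d h)))
    where
    0≤b = ℚ.<⇒≤ 0<b
    0≤h = ℚ.<⇒≤ 0<h
    0≤β = ℚ.≤-trans 0≤b b≤β
    0<bh = 0<⊗ 0<b 0<h
    u≤17h : u ≤ ι 17 * h
    u≤17h = lin ((0≤u ⊛ ℚ.≤-reflexive (sym hq²)) ⊕ (0≤ι 17 ⊗ 0≤h ⊛ small))
        (solve 3 (λ u h q → # 17 :* h :- u
          := u :* (h :* (q :* q)) :+ # 17 :* h :* # 1 :- (u :* # 1 :+ # 17 :* h :* (con (1 ÷ 17)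
            :* (u :* (q :* q))))) refl u h q)

  -- Now 18β is at least 18/32 = 1/2 + 1/16, while x is within h/2 of the fraction.
  too-close-wide : ∀ {b β d h q} → ι 1 ≤ ι 32 * b → 0ℚ < h →
    h * (q * q) ≡ 1ℚ → b ≤ β → ι 2 * d * (q * q) ≤ 1ℚ → ¬ (ι 18 * β * h ≤ d + (1 ÷ 32) * h)
  too-close-wide {b} {β} {d} {h} {q} 1≤32b 0<h hq² b≤β d≤ bad = <⇒≱ 0<h
    (*-cancel-≤ (ℚ.positive⁻¹ (1 ÷ 32))
    (lin (bad ⊕ (0≤÷ 1 2 ⊗ 0≤h ⊛ d≤) ⊕ (0≤ι 18 ⊗ 0≤h ⊛ b≤β) ⊕ (0≤÷ 9 16 ⊗ 0≤h ⊛ 1≤32b) ⊕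
          ℚ.≤-reflexive (cong (λ t → d * t) (sym hq²)))
        (solve 5 (λ b β d h q → con (1 ÷ 32) :* # 0 :- con (1 ÷ 32) :* h
          := d :+ con (1 ÷ 32) :* h :+ (con (1 ÷ 2) :* h :* # 1 :+ (# 18 :* h :* β :+
            (con (9 ÷ 16) :* h :* (# 32 :* b) :+ d :* (h :* (q :* q))))) :- (# 18 :* β :* h :+
            (con (1 ÷ 2) :* h :* (# 2 :* d :* (q :* q)) :+ (# 18 :* h :* b :+ (con (9 ÷ 16) :* h
            :* # 1 :+ d :* # 1))))) refl b β d h q)))
    where
    0≤h = ℚ.<⇒≤ 0<h

  -- The moment examined is the one at which u q² drops below 7/10. This value exceeds the 2/3 that
  -- a target requires, and it gives |x - y| ≤ 1/(2q²) ≤ 5u/7, so y is deep, as x is within about b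
  -- u of z. One round shrinks the radius at most by a factor of about b/2, whence b u q² ≤ 147/100.
  unplayed-target : ∀ {b u z y u′ x p} → 0ℚ < b → ι 32 * b ≤ ι 1 → 0ℚ < u →
    ι 7 ≤ ι 10 * u * (den y * den y) → ι 10 * u′ * (den y * den y) ≤ ι 7 →
        ι 10 * (b * u) ≤ ι 21 * u′ →
    ∣ x - z ∣ ≤ p + (1 ÷ 100) * (b * u) → p ≤ (51 ÷ 50) * (b * u) →
    ι 2 * ∣ x - y ∣ * (den y * den y) ≤ 1ℚ → Target (ι 16 * (b * b)) b z u y
  unplayed-target {b} {u} {z} {y} {u′} {x} {p} 0<b b≤ 0<u uq²≥ u′q²≤ bu≤u′ x~z p≤ x~y =
    target deep large small
    where
    q = den y
    v = u′
    0≤b = ℚ.<⇒≤ 0<b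
    0≤u = ℚ.<⇒≤ 0<u
    0≤q : 0ℚ ≤ q
    0≤q = 0≤ι (↧ₙ y)
    large : ι 2 ≤ ι 3 * (u * (q * q))
    large = lin ((0≤÷ 3 10 ⊛ uq²≥) ⊕ 0≤÷ 1 10)
        (solve 2 (λ u q → # 3 :* (u :* (q :* q)) :- # 2
          := con (3 ÷ 10) :* (# 10 :* u :* (q :* q)) :+ con (1 ÷ 10) :- (con (3 ÷ 10) :* # 7 :+
            # 0)) refl u q)
    small : ι 16 * (b * b) * (u * (q * q)) ≤ ι 1
    small = lin ((0≤÷ 8 5 ⊗ 0≤b ⊗ (0≤q ⊗ 0≤q) ⊛ bu≤u′) ⊕ (0≤÷ 84 25 ⊗ 0≤b ⊛ u′q²≤) ⊕
          (0≤÷ 147 200 ⊛ b≤) ⊕ 0≤÷ 53 200)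
        (solve 4 (λ b u q v → # 1 :- # 16 :* (b :* b) :* (u :* (q :* q))
          := con (8 ÷ 5) :* (b :* (q :* q)) :* (# 21 :* v) :+ (con (84 ÷ 25) :* b :* # 7 :+
            (con (147 ÷ 200) :* # 1 :+ con (53 ÷ 200))) :- (con (8 ÷ 5) :* (b :* (q :* q)) :*
            (# 10 :* (b :* u)) :+ (con (84 ÷ 25) :* b :* (# 10 :* v :* (q :* q)) :+
            (con (147 ÷ 200) :* (# 32 :* b) :+ # 0)))) refl b u q v)
    d = ∣ x - y ∣
    e = ∣ x - z ∣
    deep : Deep b z u y
    deep = ℚ.≤-trans (triangle y x z) (ℚ.≤-trans (ℚ.+-monoˡ-≤ e (ℚ.≤-reflexive (∣a-b∣≡∣b-a∣ y x)))
      (lin (x~z ⊕ p≤ ⊕ (0≤÷ 1 7 ⊗ ℚ.0≤∣p∣ (x - y) ⊛ uq²≥) ⊕ (0≤÷ 5 7 ⊗ 0≤u ⊛ x~y) ⊕ (0≤÷ 57 800 ⊗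
            0≤u ⊛ b≤) ⊕ (0≤÷ 1201 5600 ⊛ 0≤u))
          (solve 6 (λ b u d e p q → (# 1 :- con (5 ÷ 4) :* b) :* u :- (d :+ e)
            := p :+ con (1 ÷ 100) :* (b :* u) :+ (con (51 ÷ 50) :* (b :* u) :+ (con (1 ÷ 7) :* d
              :* (# 10 :* u :* (q :* q)) :+ (con (5 ÷ 7) :* u :* # 1 :+ (con (57 ÷ 800) :* u :*
              # 1 :+ con (1201 ÷ 5600) :* u)))) :- (e :+ (p :+ (con (1 ÷ 7) :* d :* # 7 :+
              (con (5 ÷ 7) :* u :* (# 2 :* d :* (q :* q)) :+ (con (57 ÷ 800) :* u :* (# 32 :* b)
              :+ con (1201 ÷ 5600) :* # 0)))))) refl b u d e p q)))

open Rationals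

open import Defs

-- The game

infixr 4 _&_

_&_ : ∀ {P Q} → Eventually P → Eventually Q → Eventually (λ n → P n × Q n)
_&_ = eventually-zip _,_

≃-refl : ∀ x → x ≃ x
≃-refl x = *≃* λ ε 0<ε → 0 , λ n _ →
  subst (ℚ._< ε) (cong ℚ.∣_∣ (sym (ℚ.+-inverseʳ (seq x n)))) 0<ε

eventually-gap : ∀ {x} → 0ℝ < x → ∃ λ g → 0ℚ ℚ.< g × Eventually (λ n → g ℚ.≤ seq x n)
eventually-gap (*<* g 0<g (N , h)) = g , 0<g , N , λ n N≤n →
  subst (ℚ._≤ _) (ℚ.+-identityˡ g) (h n N≤n)

approximate-ℝ : ∀ η → 0ℚ ℚ.< η → η ℚ.≤ ι 1 → ∀ x → 0ℝ < x → Approximation η (seq x)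
approximate-ℝ η 0<η η≤1 x 0<x =
  let g , 0<g , g≤ = eventually-gap {x} 0<x
  in approximate η 0<η η≤1 (cauchy x) 0<g g≤

coprime-parts : ∀ y → Coprime.Coprime ℤ.∣ ↥ y ∣ (↧ₙ y)
coprime-parts (ℚ.mkℚ _ _ c) = Coprime.recompute c

BadBeyond : ℝ → ℝ → ℕ → Set
BadBeyond δ x Q = ∀ (q : ℕ) .{{_ : ℕ.NonZero q}} → Q ℕ.≤ q →
  ∀ (p : ℤ) → Coprime.Coprime ℤ.∣ p ∣ q →
  δ * fromℚ (ℚ._/_ (+ 1) (q ℕ.* q) {{ℕ.m*n≢0 q q}}) ≤ ∣ x - fromℚ (p ℚ./ q) ∣

abstract
  inverse-square : ℚ → ℚ
  inverse-square y = 1 ÷ (↧ₙ y ℕ.* ↧ₙ y)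

  inverse-square-* : ∀ y → inverse-square y ℚ.* (den y ℚ.* den y) ≡ 1ℚ
  inverse-square-* y = trans (cong (λ t → inverse-square y ℚ.* t) (sym (ι-* (↧ₙ y) (↧ₙ y))))
      (1÷-* (↧ₙ y ℕ.* ↧ₙ y))

  inverse-square>0 : ∀ y → 0ℚ ℚ.< inverse-square y
  inverse-square>0 y = ℚ.positive⁻¹ (inverse-square y) {{ℚ.normalize-pos 1 (↧ₙ y ℕ.* ↧ₙ y)}}

  bad-at : ∀ {β x Q} → BadBeyond (fromℕ 18 * β) x Q → ∀ y → Q ℕ.≤ ↧ₙ y → ∀ ε → 0ℚ ℚ.< ε →
    Eventually λ n → ι 18 ℚ.* seq β n ℚ.* inverse-square y ℚ.≤ ℚ.∣ seq x n ℚ.- y ∣ ℚ.+ ε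
  bad-at {β} {x} bad y Q≤ ε 0<ε =
    let N , h = _≤_.below (bad (↧ₙ y) Q≤ (↥ y) (coprime-parts y)) ε 0<ε
    in N , λ n N≤n → subst (λ t →
          ι 18 ℚ.* seq β n ℚ.* inverse-square y ℚ.≤ ℚ.∣ seq x n ℚ.- t ∣ ℚ.+ ε)
      (ℚ.↥p/↧p≡p y) (h n N≤n)

-- A linear rate is weaker than the geometric one but avoids powers: k + 1 ≤ 2k for k ≥ 1.
halving-decay : ∀ (f : ℕ → ℚ) → (∀ n → 0ℚ ℚ.≤ f n) → (∀ n → ι 2 ℚ.* f (suc n) ℚ.≤ f n) →
  ∀ n → ι (suc n) ℚ.* f n ℚ.≤ f 0
halving-decay f 0≤f half zero    = ℚ.≤-reflexive (ℚ.*-identityˡ (f 0))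
halving-decay f 0≤f half (suc n) = ℚ.≤-trans
  (go (ι (suc n)) (ι-+ 1 (suc n)) (0≤ι (suc n)) (1≤ι (suc n)) (half n) (0≤f (suc n)))
      (halving-decay f 0≤f half n)
  where
  go : ∀ k {k′ v u} → k′ ≡ ι 1 ℚ.+ k → 0ℚ ℚ.≤ k → 1ℚ ℚ.≤ k → ι 2 ℚ.* v ℚ.≤ u → 0ℚ ℚ.≤ v →
      k′ ℚ.* v ℚ.≤ k ℚ.* u
  go k {_} {v} {u} refl 0≤k 1≤k h 0≤v = lin ((0≤k ⊛ h) ⊕ (0≤v ⊛ 1≤k))
      (solve 3 (λ k v u → k :* u :- (# 1 :+ k) :* v
        := k :* u :+ v :* k :- (k :* (# 2 :* v) :+ v :* # 1)) refl k v u)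

halving-vanishes : ∀ (f : ℕ → ℚ) → (∀ n → 0ℚ ℚ.≤ f n) → (∀ n → ι 2 ℚ.* f (suc n) ℚ.≤ f n) →
  ∀ t → 0ℚ ℚ.< t → ∃ λ N → ∀ n → N ℕ.≤ n → f n ℚ.≤ t
halving-vanishes f 0≤f half t 0<t =
  let N , f₀≤ = archimedean (f 0) t 0<t
  in N , λ n N≤n → *-cancel-≤ (0<ι (suc n))
    (ℚ.≤-trans (halving-decay f 0≤f half n) (ℚ.≤-trans f₀≤
      (ℚ.*-monoʳ-≤-nonNeg t {{ℚ.nonNegative (ℚ.<⇒≤ 0<t)}}
          (ι-mono-≤ (ℕ.≤-trans N≤n (ℕ.n≤1+n n))))))

-- Bob's strategy for small β

module SmallScale (β : ℝ) (b : ℚ) (0<b : 0ℚ ℚ.< b) (b≤ : ι 32 ℚ.* b ℚ.≤ ι 1)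
  (b≤β : Eventually (λ n → b ℚ.≤ seq β n))
  (β≤ : Eventually (λ n → seq β n ℚ.≤ (ι 1 ℚ.+ (1 ÷ 100)) ℚ.* b)) where

  0≤b : 0ℚ ℚ.≤ b
  0≤b = ℚ.<⇒≤ 0<b

  -- The relative precision is a fraction of b because Bob's balls have relative size β: an error of
  -- a fixed proportion of u would swamp them.
  η : ℚ
  η = (1 ÷ 8) ℚ.* b

  0<η : 0ℚ ℚ.< η
  0<η = 0<⊗ (ℚ.positive⁻¹ (1 ÷ 8)) 0<b

  abstract
    radius-approximation : ∀ A → Approximation η (seq (radius A))
    radius-approximation A = approximate-ℝ η 0<η
      (lin ((0≤÷ 1 256 ⊛ b≤) ⊕ 0≤÷ 255 256)
          (solve 1 (λ b → # 1 :- con (1 ÷ 8) :* b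
            := con (1 ÷ 256) :* # 1 :+ con (255 ÷ 256) :- (con (1 ÷ 256) :* (# 32 :* b) :+
              # 0)) refl b)) (radius A) (radius>0 A)

  u : Ball → ℚ
  u A = Approximation.value (radius-approximation A)

  0<u : ∀ A → 0ℚ ℚ.< u A
  0<u A = Approximation.0<value (radius-approximation A)

  0≤u : ∀ A → 0ℚ ℚ.≤ u A
  0≤u A = ℚ.<⇒≤ (0<u A)

  u≤radius : ∀ A → Eventually λ n → u A ℚ.≤ seq (radius A) n
  u≤radius A = Approximation.lower (radius-approximation A)

  radius≤ : ∀ A → Eventually λ n → seq (radius A) n ℚ.≤ (ι 1 ℚ.+ η) ℚ.* u A
  radius≤ A = Approximation.upper (radius-approximation A)

  abstract
    centre-approximation : ∀ A → ∃ λ z → Eventually λ n →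
        ℚ.∣ seq (centre A) n ℚ.- z ∣ ℚ.≤ η ℚ.* u A
    centre-approximation A =
      let N , close = cauchy (centre A) (η ℚ.* u A) (0<⊗ 0<η (0<u A))
      in seq (centre A) N , N , λ n N≤n → ℚ.<⇒≤ (close n N N≤n ℕ.≤-refl)

  z : Ball → ℚ
  z A = proj₁ (centre-approximation A)

  centre≈z : ∀ A → Eventually λ n → ℚ.∣ seq (centre A) n ℚ.- z A ∣ ℚ.≤ η ℚ.* u A
  centre≈z A = proj₂ (centre-approximation A)

  βr-bounds : ∀ A → Eventually λ n → b ℚ.* u A ℚ.≤ seq β n ℚ.* seq (radius A) n ×
    seq β n ℚ.* seq (radius A) n ℚ.≤ (51 ÷ 50) ℚ.* (b ℚ.* u A)
  βr-bounds A = eventually-map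
    (λ (h₁ , h₂ , h₃ , h₄) → product-bounds 0<b b≤ (0<u A) h₁ h₂ h₃ h₄)
    (b≤β & β≤ & u≤radius A & radius≤ A)

  ballAt : ℚ → Ball → Ball
  ballAt y A = record
    { centre   = fromℚ y
    ; radius   = β * radius A
    ; radius>0 = *<* (b ℚ.* u A) (0<⊗ 0<b (0<u A)) (eventually-map
        (λ (h , _) → subst (ℚ._≤ _) (sym (ℚ.+-identityˡ (b ℚ.* u A))) h) (βr-bounds A))
    }

  ballAt-legal : ∀ y A → Deep b (z A) (u A) y → ballAt y A ∈ A ^ β
  ballAt-legal y A deep = (λ x x∈ → *≤* λ ε 0<ε → eventually-map
      (λ {n} (h , c , u≤r , βn≤) → deep⇒legal {c = seq (centre A) n} {a = seq x n} 0<b b≤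
          (0<u A) deep c u≤r
        (ℚ.*-monoʳ-≤-nonNeg _ {{ℚ.nonNegative (ℚ.≤-trans (0≤u A) u≤r)}} βn≤) h)
      (_≤_.below x∈ ε 0<ε & centre≈z A & u≤radius A & β≤))
    , ≃-refl (β * radius A)

  -- Of the inclusion of Alice's ball in Bob's, only the membership of her two endpoints is used.
  legal-step : ∀ y A A′ → A′ ∈ ballAt y A ^ ½ℝ → Step b (u A) y (z A′) (u A′)
  legal-step y A A′ (A′⊆ , *≃* half) =
    let n , (bu≤p , p≤) , c , v≤r , r≤ , right , left , h = eventually⇒∃
          (βr-bounds A & centre≈z A′ & u≤radius A′ & radius≤ A′ &
            _≤_.below (A′⊆ (centre A′ + radius A′) end₁) ε 0<ε &
            _≤_.below (A′⊆ (centre A′ - radius A′) end₂) ε 0<ε &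
            half ε 0<ε)
    in legal-step-bounds {c = seq (centre A′) n} 0<b b≤ (0<u A′) c v≤r r≤ bu≤p p≤ right left
          (ℚ.<⇒≤ h)
    where
    ε = (1 ÷ 12) ℚ.* (b ℚ.* u A′)
    0<ε : 0ℚ ℚ.< ε
    0<ε = 0<⊗ (ℚ.positive⁻¹ (1 ÷ 12)) (0<⊗ 0<b (0<u A′))
    at-end : ∀ {a c r ε} → 0ℚ ℚ.≤ r → 0ℚ ℚ.< ε →
        (a ≡ r ⊎ a ≡ ℚ.- r) → ℚ.∣ c ℚ.+ a ℚ.- c ∣ ℚ.≤ r ℚ.+ ε
    at-end {a} {c} {r} {ε} 0≤r 0<ε e = subst (λ t → ℚ.∣ t ∣ ℚ.≤ r ℚ.+ ε) (solve 2 (λ a c → a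
          := c :+ a :- c) refl a c)
      (ℚ.≤-trans (ℚ.≤-reflexive (∣a∣≡ e)) (lin (ℚ.<⇒≤ 0<ε)
          (solve 2 (λ r ε → r :+ ε :- r := ε :- # 0) refl r ε)))
      where
      ∣a∣≡ : (a ≡ r ⊎ a ≡ ℚ.- r) → ℚ.∣ a ∣ ≡ r
      ∣a∣≡ (inj₁ refl) = ℚ.0≤p⇒∣p∣≡p 0≤r
      ∣a∣≡ (inj₂ refl) = trans (ℚ.∣-p∣≡∣p∣ r) (ℚ.0≤p⇒∣p∣≡p 0≤r)
    end₁ : (centre A′ + radius A′) ∈ A′
    end₁ = *≤* λ ε 0<ε → eventually-map
        (λ {n} u≤r → at-end {c = seq (centre A′) n} (ℚ.≤-trans (0≤u A′) u≤r) 0<ε (inj₁ refl))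
            (u≤radius A′)
    end₂ : (centre A′ - radius A′) ∈ A′
    end₂ = *≤* λ ε 0<ε → eventually-map
        (λ {n} u≤r → at-end {c = seq (centre A′) n} (ℚ.≤-trans (0≤u A′) u≤r) 0<ε (inj₂ refl))
            (u≤radius A′)

  step-halves : ∀ {y A A′} → Step b (u A) y (z A′) (u A′) → ι 2 ℚ.* u A′ ℚ.≤ u A
  step-halves {y} {A} {A′} st = go {u A} {u A′} (0≤u A) (Step.u′≤bu st)
    where
    go : ∀ {u v} → 0ℚ ℚ.≤ u → ι 200 ℚ.* v ℚ.≤ ι 103 ℚ.* (b ℚ.* u) → ι 2 ℚ.* v ℚ.≤ u
    go {u} {v} 0≤u h = lin ((0≤÷ 1 100 ⊛ h) ⊕ (0≤÷ 103 3200 ⊗ 0≤u ⊛ b≤) ⊕ (0≤÷ 3097 3200 ⊛ 0≤u))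
        (solve 3 (λ b u v → u :- # 2 :* v
          := con (1 ÷ 100) :* (# 103 :* (b :* u)) :+ (con (103 ÷ 3200) :* u :* # 1 :+
            con (3097 ÷ 3200) :* u) :- (con (1 ÷ 100) :* (# 200 :* v) :+ (con (103 ÷ 3200) :* u
            :* (# 32 :* b) :+ con (3097 ÷ 3200) :* # 0))) refl b u v)

  Hit Detours Prepared : Ball → Set
  Hit A      = ∃ (Target (1 ÷ 17) b (z A) (u A))
  Detours A  = ∃ λ y → ∃₂ (Detour b (z A) (u A) y)
  Prepared A = ∃ (Target (ι 16 ℚ.* (b ℚ.* b)) b (z A) (u A))

  -- The refutations record the order of preference; they make it possible to conclude from the
  -- existence of a hit that Bob's move is a hit, and similarly below it.
  data Move (A : Ball) : Set where
    hit     : Hit A → Move A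
    swerve  : ¬ Hit A → Detours A → Move A
    prepare : ¬ Hit A → ¬ Detours A → Prepared A → Move A
    wait    : ¬ Hit A → ¬ Detours A → ¬ Prepared A → Move A

  abstract
    choose : ∀ A → Move A
    choose A = select (∃Target? (ℚ.positive⁻¹ (1 ÷ 17)) 0<b (0<u A)) (∃Detour? 0<b (0<u A))
      (∃Target? (0<⊗ (0<ι 16) (0<⊗ 0<b 0<b)) 0<b (0<u A))
      where
      select : Dec (Hit A) → Dec (Detours A) → Dec (Prepared A) → Move A
      select (yes h) _       _       = hit h
      select (no ¬h) (yes d) _       = swerve ¬h d
      select (no ¬h) (no ¬d) (yes p) = prepare ¬h ¬d p
      select (no ¬h) (no ¬d) (no ¬p) = wait ¬h ¬d ¬p

  destination : ∀ {A} → Move A → ℚ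
  destination (hit (y , _))              = y
  destination (swerve _ (y , n , s , _)) = aside y n s
  destination (prepare _ _ (y , _))      = y
  destination {A} (wait _ _ _)           = z A

  destination-deep : ∀ {A} (m : Move A) → Deep b (z A) (u A) (destination m)
  destination-deep (hit (_ , t))              = Target.deep t
  destination-deep (swerve _ (_ , _ , _ , d)) = Detour.deep d
  destination-deep (prepare _ _ (_ , t))      = Target.deep t
  destination-deep {A} (wait _ _ _) = ℚ.≤-trans
    (ℚ.≤-reflexive (cong ℚ.∣_∣ (ℚ.+-inverseʳ (z A)))) (go (0≤u A))
    where
    go : ∀ {u} → 0ℚ ℚ.≤ u → 0ℚ ℚ.≤ (ι 1 ℚ.- (5 ÷ 4) ℚ.* b) ℚ.* u
    go {u} 0≤u = lin ((0≤÷ 5 128 ⊗ 0≤u ⊛ b≤) ⊕ (0≤÷ 123 128 ⊛ 0≤u))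
        (solve 2 (λ b u → (# 1 :- con (5 ÷ 4) :* b) :* u :- # 0
          := con (5 ÷ 128) :* u :* # 1 :+ con (123 ÷ 128) :* u :- (con (5 ÷ 128) :* u :* (# 32
            :* b) :+ con (123 ÷ 128) :* # 0)) refl b u)

  strategy : Strategy β
  strategy = record
    { reply = λ _ A → ballAt (destination (choose A)) A
    ; legal = λ _ A → ballAt-legal (destination (choose A)) A (destination-deep (choose A))
    }

  -- A play that ends in a badly approximable point

  module Play (B₁ : Ball) (A : ℕ → Ball) (A-legal : ∀ n → A n ∈ bob B₁ strategy A n ^ ½ℝ)
    (x : ℝ) (x∈ : ∀ n → x ∈ bob B₁ strategy A n)
    (irr : Irrational x) (Q : ℕ) (bad : BadBeyond (fromℕ 18 * β) x Q) where

    y : ℕ → ℚ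
    y n = destination (choose (A n))

    v : ℕ → ℚ
    v n = u (A n)

    stepAt : ∀ n → Step b (v n) (y n) (z (A (suc n))) (v (suc n))
    stepAt n = legal-step (y n) (A n) (A (suc n)) (A-legal (suc n))

    near-y : ∀ n ε → 0ℚ ℚ.< ε → Eventually λ k →
      ℚ.∣ seq x k ℚ.- y n ∣ ℚ.≤ seq β k ℚ.* seq (radius (A n)) k ℚ.+ ε
    near-y n = _≤_.below (x∈ (suc n))

    -- A target has 3 u q² ≥ 2, which is impossible for u ≤ 1/(1 + 3Q²) and q ≤ Q. The summand 1
    -- covers Q = 0 and gives t ≤ 1.
    threshold : ∃ λ t → 0ℚ ℚ.< t × t ℚ.* ι (suc (3 ℕ.* (Q ℕ.* Q))) ≡ 1ℚ
    threshold = reciprocal (ι (suc (3 ℕ.* (Q ℕ.* Q)))) (0<ι (suc (3 ℕ.* (Q ℕ.* Q))))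

    t : ℚ
    t = proj₁ threshold

    t-split : t ℚ.* (ι 1 ℚ.+ ι 3 ℚ.* (ι Q ℚ.* ι Q)) ≡ 1ℚ
    t-split = trans (cong (λ k → t ℚ.* k) (sym (trans (ι-+ 1 (3 ℕ.* (Q ℕ.* Q)))
      (cong (λ k → ι 1 ℚ.+ k) (trans (ι-* 3 (Q ℕ.* Q)) (cong (λ k → ι 3 ℚ.* k) (ι-* Q Q)))))))
      (proj₂ (proj₂ threshold))

    0≤t : 0ℚ ℚ.≤ t
    0≤t = ℚ.<⇒≤ (proj₁ (proj₂ threshold))

    t≤1 : t ℚ.≤ ι 1
    t≤1 = go (0≤square (ι Q)) t-split
      where
      go : ∀ {s} → 0ℚ ℚ.≤ s → t ℚ.* (ι 1 ℚ.+ ι 3 ℚ.* s) ≡ 1ℚ → t ℚ.≤ ι 1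
      go {s} 0≤s e = lin (ℚ.≤-reflexive e ⊕ (0≤ι 3 ⊗ 0≤t ⊛ 0≤s))
          (solve 2 (λ t s → # 1 :- t
            := # 1 :+ # 3 :* t :* s :- (t :* (# 1 :+ # 3 :* s) :+ # 3 :* t :* # 0)) refl t s)

    hit⇒Q≤ : ∀ n → v n ℚ.≤ t → ∀ {U} y → Target U b (z (A n)) (v n) y → Q ℕ.≤ ↧ₙ y
    hit⇒Q≤ n v≤t y T = ℕ.≮⇒≥ λ q<Q →
      <⇒≱ (ℚ.positive⁻¹ 1ℚ) (go (0≤ι (↧ₙ y)) (ι-mono-≤ (ℕ.<⇒≤ q<Q)) (0≤u (A n)) v≤t t-split
          (Target.large T))
      where
      go : ∀ {q Q w} → 0ℚ ℚ.≤ q → q ℚ.≤ Q → 0ℚ ℚ.≤ w → w ℚ.≤ t →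
          t ℚ.* (ι 1 ℚ.+ ι 3 ℚ.* (Q ℚ.* Q)) ≡ 1ℚ →
        ι 2 ℚ.≤ ι 3 ℚ.* (w ℚ.* (q ℚ.* q)) → 1ℚ ℚ.≤ 0ℚ
      go {q} {Q} {w} 0≤q q≤Q 0≤w w≤t e h =
        lin (h ⊕ (0≤ι 3 ⊗ 0≤q ⊗ 0≤q ⊛ w≤t) ⊕ ((0≤ι 3 ⊗ 0≤t) ⊗ 0≤q ⊛ q≤Q) ⊕ ((0≤ι 3 ⊗ 0≤t) ⊗
              ℚ.≤-trans 0≤q q≤Q ⊛ q≤Q) ⊕ ℚ.≤-reflexive e ⊕ 0≤t)
            (solve 4 (λ q Q w t → # 0 :- # 1
              := # 3 :* (w :* (q :* q)) :+ (# 3 :* (q :* q) :* t :+ (# 3 :* t :* q :* Q :+ (# 3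
                :* t :* Q :* Q :+ (# 1 :+ t)))) :- (# 2 :+ (# 3 :* (q :* q) :* w :+ (# 3 :* t :*
                q :* q :+ (# 3 :* t :* Q :* q :+ (t :* (# 1 :+ # 3 :* (Q :* Q)) :+
                # 0)))))) refl q Q w t)

    start : ∃ λ N → ∀ n → N ℕ.≤ n → v n ℚ.≤ t
    start = halving-vanishes v (λ n → 0≤u (A n)) (λ n → step-halves (stepAt n)) t
        (proj₁ (proj₂ threshold))

    n₀ : ℕ
    n₀ = proj₁ start

    v≤t : ∀ n → n₀ ℕ.≤ n → v n ℚ.≤ t
    v≤t = proj₂ start

    -- From n₀ on, a hit contradicts the badness of x, a swerve leads to a hit and
    -- a preparation to a swerve; so Bob only waits.
    no-hit : ∀ n → n₀ ℕ.≤ n → ¬ Hit (A n)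
    no-hit n n₀≤n h = go (choose (A n)) refl
      where
      go : (m : Move (A n)) → destination m ≡ y n → ⊥
      go (swerve ¬h _)    _ = ¬h h
      go (prepare ¬h _ _) _ = ¬h h
      go (wait ¬h _ _)    _ = ¬h h
      -- The given hit h only forces Bob to make some hit; the contradiction comes from the fraction
      -- y′ that he actually chose.
      go (hit (y′ , T)) y′≡ =
        let _ , near , far , b≤β , r≤ = eventually⇒∃ (
              subst (λ c → Eventually λ k → ℚ.∣ seq x k ℚ.- c ∣ ℚ.≤ seq β k ℚ.* seq
                  (radius (A n)) k ℚ.+ ε)
                (sym y′≡) (near-y n ε 0<ε) &
              bad-at {β} {x} bad y′ (hit⇒Q≤ n (v≤t n n₀≤n) y′ T) ε 0<ε &
              b≤β & radius≤ (A n))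
        in too-close {q = den y′} 0<b b≤ (inverse-square>0 y′) (0≤u (A n))
             (inverse-square-* y′) (Target.small T) b≤β r≤ near far
        where
        ε = (1 ÷ 4) ℚ.* (b ℚ.* inverse-square y′)
        0<ε : 0ℚ ℚ.< ε
        0<ε = 0<⊗ (ℚ.positive⁻¹ (1 ÷ 4)) (0<⊗ 0<b (inverse-square>0 y′))

    no-detour : ∀ n → n₀ ℕ.≤ n → ¬ Detours (A n)
    no-detour n n₀≤n d = go (choose (A n)) refl
      where
      go : (m : Move (A n)) → destination m ≡ y n → ⊥
      go (hit h)          _ = no-hit n n₀≤n h
      go (prepare _ ¬d _) _ = ¬d d
      go (wait _ ¬d _)    _ = ¬d d
      go (swerve _ (y′ , k , s , D)) y′≡ = no-hit (suc n) (ℕ.m≤n⇒m≤1+n n₀≤n)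
        (detour⇒target 0<b b≤ (0<u (A n)) D
          (subst (λ c → Step b (v n) c (z (A (suc n))) (v (suc n))) (sym y′≡) (stepAt n)))

    no-preparation : ∀ n → n₀ ℕ.≤ n → ¬ Prepared (A n)
    no-preparation n n₀≤n p = go (choose (A n)) refl
      where
      go : (m : Move (A n)) → destination m ≡ y n → ⊥
      go (hit h)       _ = no-hit n n₀≤n h
      go (swerve _ d)  _ = no-detour n n₀≤n d
      go (wait _ _ ¬p) _ = ¬p p
      go (prepare _ _ (y′ , T)) y′≡ = no-detour (suc n) (ℕ.m≤n⇒m≤1+n n₀≤n)
        (y′ , target⇒detour 0<b b≤ (0<u (A n)) (ℚ.≤-trans (v≤t n n₀≤n) t≤1) T
          (subst (λ c → Step b (v n) c (z (A (suc n))) (v (suc n))) (sym y′≡) (stepAt n)))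

    only-waiting : ∀ n → n₀ ℕ.≤ n → y n ≡ z (A n)
    only-waiting n n₀≤n = go (choose (A n))
      where
      go : (m : Move (A n)) → destination m ≡ z (A n)
      go (hit h)         = contradiction h (no-hit n n₀≤n)
      go (swerve _ d)    = contradiction d (no-detour n n₀≤n)
      go (prepare _ _ p) = contradiction p (no-preparation n n₀≤n)
      go (wait _ _ _)    = refl

    -- While Bob waits, u q² decreases by factors of about b / 2 for every good
    -- approximation p/q of x, in steps too small to jump over the range of Prepared.
    loses : ⊥
    loses = good-approximations x irr K λ (c , K≤q , c≈x) →
      let w = λ k → v (k ℕ.+ n₀)
          Early = λ k → ι 10 ℚ.* w k ℚ.* (den c ℚ.* den c) ℚ.< ι 7
          N , w≤ = halving-vanishes w (λ k → 0≤u (A (k ℕ.+ n₀)))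
              (λ k → step-halves (stepAt (k ℕ.+ n₀)))
                     (proj₁ (bound c)) (proj₁ (proj₂ (bound c)))
          k , late , first = least (λ k → ι 10 ℚ.* w k ℚ.* (den c ℚ.* den c) ℚ.<? ι 7) N
                     (proj₂ (proj₂ (bound c)) (w≤ N ℕ.≤-refl))
      in before c c≈x (start-large c K≤q) k late first
      where
      -- K makes u q² at least 7/10 at n₀, so that the drop below 7/10 happens in a later round,
      -- after Bob has begun to wait.
      K = proj₁ (archimedean (ι 7) (ι 10 ℚ.* v n₀) (0<⊗ (0<ι 10) (0<u (A n₀))))
      7≤ = proj₂ (archimedean (ι 7) (ι 10 ℚ.* v n₀) (0<⊗ (0<ι 10) (0<u (A n₀))))
      start-large : ∀ c → K ℕ.≤ ↧ₙ c → ι 7 ℚ.≤ ι 10 ℚ.* v n₀ ℚ.* (den c ℚ.* den c)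
      start-large c K≤q = go (ι-mono-≤ K≤q) (1≤ι↧ c) (0≤u (A n₀)) 7≤
        where
        go : ∀ {k q w} → k ℚ.≤ q → 1ℚ ℚ.≤ q → 0ℚ ℚ.≤ w → ι 7 ℚ.≤ k ℚ.* (ι 10 ℚ.* w) →
            ι 7 ℚ.≤ ι 10 ℚ.* w ℚ.* (q ℚ.* q)
        go {k} {q} {w} k≤q 1≤q 0≤w h = lin (h ⊕ (0≤ι 10 ⊗ 0≤w ⊛ k≤q) ⊕ ((0≤ι 10 ⊗ 0≤w) ⊗
              ℚ.≤-trans (0≤ι 1) 1≤q ⊛ 1≤q))
            (solve 3 (λ k q w → # 10 :* w :* (q :* q) :- # 7
              := k :* (# 10 :* w) :+ (# 10 :* w :* q :+ # 10 :* w :* q :* q) :- (# 7 :+ (# 10 :*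
                w :* k :+ # 10 :* w :* q :* # 1))) refl k q w)
      bound : ∀ c → ∃ λ e → 0ℚ ℚ.< e ×
          (∀ {w} → w ℚ.≤ e → ι 10 ℚ.* w ℚ.* (den c ℚ.* den c) ℚ.< ι 7)
      bound c = (1 ÷ 10) ℚ.* inverse-square c , 0<⊗ (ℚ.positive⁻¹ (1 ÷ 10)) (inverse-square>0 c)
        , λ {w} w≤e → ℚ.≤-<-trans (go {den c ℚ.* den c} {inverse-square c} {w}
            (0≤square (den c)) w≤e (inverse-square-* c)) (ℚ.*<* (ℤ.+<+ (ℕ.s≤s (ℕ.s≤s ℕ.z≤n))))
        where
        go : ∀ {s h w} → 0ℚ ℚ.≤ s → w ℚ.≤ (1 ÷ 10) ℚ.* h → h ℚ.* s ≡ 1ℚ → ι 10 ℚ.* w ℚ.* s ℚ.≤ 1ℚ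
        go {s} {h} {w} 0≤s w≤ e = lin ((0≤ι 10 ⊗ 0≤s ⊛ w≤) ⊕ ℚ.≤-reflexive e)
            (solve 3 (λ s h w → # 1 :- # 10 :* w :* s
              := # 10 :* s :* (con (1 ÷ 10) :* h) :+ # 1 :- (# 10 :* s :* w :+ h :*
                s)) refl s h w)
      before : ∀ c → Approximates x c → ι 7 ℚ.≤ ι 10 ℚ.* v n₀ ℚ.* (den c ℚ.* den c) →
        ∀ k → ι 10 ℚ.* v (k ℕ.+ n₀) ℚ.* (den c ℚ.* den c) ℚ.< ι 7 →
        (∀ j → k ≡ suc j → ¬ (ι 10 ℚ.* v (j ℕ.+ n₀) ℚ.* (den c ℚ.* den c) ℚ.< ι 7)) → ⊥
      before c c≈x large zero    late _     = <⇒≱ late large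
      before c c≈x large (suc j) late first =
        let i , (_ , p≤) , near , close = eventually⇒∃ (βr-bounds (A n) &
              subst (λ d → Eventually λ k → ℚ.∣ seq x k ℚ.- d ∣ ℚ.≤ seq β k ℚ.* seq
                  (radius (A n)) k ℚ.+ ε)
                (only-waiting n n₀≤n) (near-y n ε 0<ε) &
              c≈x)
        in no-preparation n n₀≤n (c , unplayed-target {y = c} {u′ = v (suc n)} {x = seq x i} 0<b
              b≤ (0<u (A n))
             (ℚ.≮⇒≥ (first j refl)) (ℚ.<⇒≤ late) (Step.bu≤u′ (stepAt n)) near p≤ close)
        where
        n = j ℕ.+ n₀
        n₀≤n = ℕ.m≤n+m n₀ j
        ε = (1 ÷ 100) ℚ.* (b ℚ.* v n)
        0<ε : 0ℚ ℚ.< ε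
        0<ε = 0<⊗ (ℚ.positive⁻¹ (1 ÷ 100)) (0<⊗ 0<b (0<u (A n)))

-- Large β, where any legal play will do

module WideScale (β : ℝ) (β≤½ : β ≤ ½ℝ) (b : ℚ) (0<b : 0ℚ ℚ.< b) (1≤32b : ι 1 ℚ.≤ ι 32 ℚ.* b)
  (b≤β : Eventually (λ n → b ℚ.≤ seq β n)) where

  concentric : Ball → Ball
  concentric A = record
    { centre   = centre A
    ; radius   = β * radius A
    ; radius>0 =
        let g , 0<g , g≤ = eventually-gap {radius A} (radius>0 A)
        in *<* (b ℚ.* g) (0<⊗ 0<b 0<g) (eventually-map
             (λ (g≤r , b≤β) → product≥ 0<g g≤r b≤β) (g≤ & b≤β))
    }
    where
    product≥ : ∀ {g r c} → 0ℚ ℚ.< g → g ℚ.≤ r → b ℚ.≤ c → 0ℚ ℚ.+ b ℚ.* g ℚ.≤ c ℚ.* r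
    product≥ {g} {r} {c} 0<g g≤r b≤c = lin ((ℚ.<⇒≤ 0<b ⊛ g≤r) ⊕ (ℚ.≤-trans (ℚ.<⇒≤ 0<g) g≤r ⊛
          b≤c))
        (solve 4 (λ b g r c → c :* r :- (# 0 :+ b :* g)
          := b :* r :+ r :* c :- (b :* g :+ r :* b)) refl b g r c)

  concentric-legal : ∀ A → concentric A ∈ A ^ β
  concentric-legal A = (λ x x∈ → *≤* λ ε 0<ε →
      let g , 0<g , g≤ = eventually-gap {radius A} (radius>0 A)
      in eventually-map (λ (h , g≤r , β≤) → ℚ.≤-trans h (shrink (ℚ.≤-trans (ℚ.<⇒≤ 0<g) g≤r) β≤))
           (_≤_.below x∈ ε 0<ε & g≤ & _≤_.below β≤½ (1 ÷ 2) (ℚ.positive⁻¹ (1 ÷ 2))))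
    , ≃-refl (β * radius A)
    where
    shrink : ∀ {r c ε} → 0ℚ ℚ.≤ r → c ℚ.≤ (1 ÷ 2) ℚ.+ (1 ÷ 2) → c ℚ.* r ℚ.+ ε ℚ.≤ r ℚ.+ ε
    shrink {r} {c} {ε} 0≤r c≤ = lin ((0≤r ⊛ c≤))
        (solve 3 (λ r c ε → r :+ ε :- (c :* r :+ ε)
          := r :* (con (1 ÷ 2) :+ con (1 ÷ 2)) :- r :* c) refl r c ε)

  concentric-strategy : Strategy β
  concentric-strategy = record { reply = λ _ → concentric ; legal = λ _ → concentric-legal }

  no-bad : ∀ x → Irrational x → ∀ Q → ¬ BadBeyond (fromℕ 18 * β) x Q
  no-bad x irr Q bad = good-approximations x irr Q λ (y , Q≤q , y≈x) →
    let ε = (1 ÷ 32) ℚ.* inverse-square y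
        0<ε = 0<⊗ (ℚ.positive⁻¹ (1 ÷ 32)) (inverse-square>0 y)
        n , far , close , b≤β = eventually⇒∃ (bad-at {β} {x} bad y Q≤q ε 0<ε & y≈x & b≤β)
    in too-close-wide {d = ℚ.∣ seq x n ℚ.- y ∣} {q = den y} 1≤32b (inverse-square>0 y)
          (inverse-square-* y) b≤β close far

theorem1p9 : ∀ (β : ℝ) → 0ℝ < β → β ≤ ½ℝ →
    UbiquitouslyLosing ½ℝ β (Bad (fromℕ 18 * β))
theorem1p9 β 0<β β≤½ B₁ = decide (approximate-ℝ (1 ÷ 100) (ℚ.positive⁻¹ (1 ÷ 100))
    (ℚ.≤ᵇ⇒≤ {1 ÷ 100} {ι 1} _) β 0<β)
  where
  decide : Approximation (1 ÷ 100) (seq β) → Σ (Strategy β) λ σ →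
    ∀ (A : ℕ → Ball) → (∀ n → A n ∈ bob B₁ σ A n ^ ½ℝ) →
    ∀ x → (∀ n → x ∈ bob B₁ σ A n) → ¬ Bad (fromℕ 18 * β) x
  -- The cases are separated by the rational b, because the comparison of the real β with 1/32 is
  -- not decidable.
  decide (approximation b 0<b b≤β β≤) with ℚ.≤-total (ι 32 ℚ.* b) (ι 1)
  ... | inj₁ small = strategy , λ A A-legal x x∈ (irr , Q , _ , bad) →
    Play.loses B₁ A A-legal x x∈ irr Q bad
    where open SmallScale β b 0<b small b≤β β≤
  ... | inj₂ wide = concentric-strategy , λ A _ x _ (irr , Q , _ , bad) → no-bad x irr Q bad
    where open WideScale β β≤½ b 0<b wide b≤β
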